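{- Let $F(n)=2(2n^2+3n-2)^2(2n^2+4n-1)$. Let $G$ be a finitely generated group which is neither generalized dicyclic nor abelian. (1) If $G$ contains an element of order at least $F(32\operatorname{rank}(G)^{6})$, then it has a GRR of valency at most $32\operatorname{rank}(G)^{6}$. (2) If $G$ has no elements of order $4$ or no non-trivial characteristic abelian subgroups, then this bound can be lowered: if $G$ contains an element of order at least $F(18\operatorname{rank}(G)^2+84\operatorname{rank}(G)-4)$, then $G$ has a GRR of valency at most $18\operatorname{rank}(G)^2+84\operatorname{rank}(G)$. (3) If moreover $G$ has elements of arbitrarily large order, then for every finite generating set $S$ there exists a symmetric set $T$ containing $S$ such that $\mathrm{Cay}(G,T)$ is a GRR for $G$ with $|T|\leq 32|S|^6$, or with $|T|\leq 18|S|^2+84|S|$ if $G$ has no elements of order $4$ or no non-trivial characteristic abelian subgroups.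
   Context: Generating sets never contain the identity. $\mathrm{Cay}(G,S)$ is the simple undirected graph with vertex set $G$ and edge set $\{(g,h)\mid g^{ -1}h\in S\cup S^{ -1}\}$. It is a graphical regular representation (GRR) of $G$ if its only automorphisms are the left multiplications by elements of $G$. $\operatorname{rank}(G)$ is the smallest cardinality of a generating set of $G$. A set $T$ is symmetric if $T=T^{ -1}$. Elements of infinite order count as having order at least any given number. A group is generalized dicyclic if it is non-abelian and has an abelian normal subgroup $A$ of index $2$ and an element $x\notin A$ of order $4$ with $xax^{ -1}=a^{ -1}$ for every $a\in A$. -}

module Defs where

open import Algebra.Bundles using (Group)
import Algebra.Definitions
import Algebra.Definitions.RawMonoid
open import Algebra.Morphism.Structures using (module GroupMorphisms)
import Algebra.Properties.Group
open import Data.Fin.Base using (Fin)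
open import Data.List.Base using (List; length)
import Data.List.Membership.Setoid
import Data.List.Relation.Unary.Unique.Setoid
open import Data.Nat.Base using (ℕ; _+_; _*_; _∸_; _^_; _≤_; _<_)
open import Data.Product.Base using (_×_; ∃; _,_)
open import Data.Product using (∃!)
open import Data.Sum.Base using (inj₁; inj₂)
open import Function.Bundles using (_⇔_)
open import Function.Definitions using (Congruent; Bijective)
open import Level using (Level; _⊔_; suc)
open import Relation.Binary.Bundles using (Setoid)
open import Relation.Binary.Core using (Rel)
open import Relation.Binary.Definitions using (Symmetric; _Respects_; _Respects₂_)
open import Relation.Binary.PropositionalEquality.Core using (_≡_)
open import Relation.Nullary.Negation.Core using (¬_)
open import Relation.Unary using (Pred; _∪_; _≐_)

private
  variable
    c ℓ e p : Level

-- Truncated subtraction is harmless for n ≥ 1.  F is only applied to polynomials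
-- in rank(G) that are positive, since a non-abelian group has rank at least 2.
F : ℕ → ℕ
F n = 2 * (2 * n ^ 2 + 3 * n ∸ 2) ^ 2 * (2 * n ^ 2 + 4 * n ∸ 1)

HasCardinality : (X : Setoid c ℓ) → Pred (Setoid.Carrier X) p → ℕ → Set (c ⊔ ℓ ⊔ p)
HasCardinality X P n =
  ∃ λ (xs : List Carrier) → Unique xs × (∀ x → P x ⇔ (x ∈ xs)) × length xs ≡ n
  where
  open Setoid X
  open Data.List.Membership.Setoid X using (_∈_)
  open Data.List.Relation.Unary.Unique.Setoid X using (Unique)

record SimpleGraph (V : Setoid c ℓ) e : Set (c ⊔ ℓ ⊔ suc e) where
  open Setoid V
  field
    Adj           : Rel Carrier e
    adj-resp-≈    : Adj Respects₂ _≈_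
    adj-sym       : Symmetric Adj
    adj-irrefl    : ∀ x → ¬ Adj x x

module _ {V : Setoid c ℓ} (Γ : SimpleGraph V e) where
  open Setoid V
  open SimpleGraph Γ

  record IsGraphAutomorphism (f : Carrier → Carrier) : Set (c ⊔ ℓ ⊔ e) where
    field
      cong      : Congruent _≈_ _≈_ f
      bijective : Bijective _≈_ _≈_ f
      adj       : ∀ x y → Adj x y ⇔ Adj (f x) (f y)

  HasValency : ℕ → Set (c ⊔ ℓ ⊔ e)
  HasValency d = ∀ x → HasCardinality V (Adj x) d

module _ (G : Group c ℓ) where
  open Group G
  open Algebra.Definitions _≈_ using (Commutative)
  open Algebra.Definitions.RawMonoid rawMonoid using () renaming (_×_ to power)
  open GroupMorphisms rawGroup rawGroup using (IsGroupIsomorphism)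

  Subset : Set (suc (c ⊔ ℓ))
  Subset = Pred Carrier (c ⊔ ℓ)

  Inv : Subset → Subset
  Inv S x = S (x ⁻¹)

  IsSymmetricSet : Subset → Set (c ⊔ ℓ)
  IsSymmetricSet T = T ≐ Inv T

  data Generated (S : Subset) : Pred Carrier (c ⊔ ℓ) where
    gen  : ∀ {x} → S x → Generated S x
    unit : Generated S ε
    mul  : ∀ {x y} → Generated S x → Generated S y → Generated S (x ∙ y)
    inv  : ∀ {x} → Generated S x → Generated S (x ⁻¹)
    resp : ∀ {x y} → x ≈ y → Generated S x → Generated S y

  record IsGeneratingSet (S : Subset) : Set (c ⊔ ℓ) where
    field
      resp-≈    : S Respects _≈_
      ε∉        : ¬ S ε
      generates : ∀ x → Generated S x

  HasSize : Subset → ℕ → Set (c ⊔ ℓ)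
  HasSize = HasCardinality setoid

  FinitelyGenerated : Set (suc (c ⊔ ℓ))
  FinitelyGenerated = ∃ λ S → IsGeneratingSet S × ∃ λ n → HasSize S n

  HasRank : ℕ → Set (suc (c ⊔ ℓ))
  HasRank r = (∃ λ S → IsGeneratingSet S × HasSize S r)
            × (∀ S n → IsGeneratingSet S → HasSize S n → r ≤ n)

  Cay : (S : Subset) → IsGeneratingSet S → SimpleGraph setoid (c ⊔ ℓ)
  Cay S S-gen = record
    { Adj        = λ g h → (S ∪ Inv S) (g ⁻¹ ∙ h)
    ; adj-resp-≈ = (λ y≈z → ∪-resp (∙-congˡ y≈z))
                 , (λ y≈z → ∪-resp (∙-congʳ (⁻¹-cong y≈z)))
    ; adj-sym    = λ where
        (inj₁ s) → inj₂ (resp-≈ (sym (flip-edge _ _)) s)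
        (inj₂ s) → inj₁ (resp-≈ (flip-edge _ _) s)
    ; adj-irrefl = λ where
        x (inj₁ s) → ε∉ (resp-≈ (inverseˡ x) s)
        x (inj₂ s) → ε∉ (resp-≈ (trans (⁻¹-cong (inverseˡ x)) ε⁻¹≈ε) s)
    }
    where
    open IsGeneratingSet S-gen
    open Algebra.Properties.Group G using (⁻¹-anti-homo-∙; ⁻¹-involutive; ε⁻¹≈ε)

    ∪-resp : (S ∪ Inv S) Respects _≈_
    ∪-resp x≈y (inj₁ s) = inj₁ (resp-≈ x≈y s)
    ∪-resp x≈y (inj₂ s) = inj₂ (resp-≈ (⁻¹-cong x≈y) s)

    flip-edge : ∀ g h → (g ⁻¹ ∙ h) ⁻¹ ≈ h ⁻¹ ∙ g
    flip-edge g h = trans (⁻¹-anti-homo-∙ (g ⁻¹) h) (∙-congˡ (⁻¹-involutive g))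

  IsGRR : SimpleGraph setoid e → Set (c ⊔ ℓ ⊔ e)
  IsGRR Γ = ∀ f → IsGraphAutomorphism Γ f → ∃ λ g → ∀ x → f x ≈ g ∙ x

  HasGRROfValencyAtMost : ℕ → Set (suc (c ⊔ ℓ))
  HasGRROfValencyAtMost k =
    ∃ λ S → ∃ λ (S-gen : IsGeneratingSet S) →
      IsGRR (Cay S S-gen) × ∃ λ d → HasValency (Cay S S-gen) d × d ≤ k

  HasOrder : Carrier → ℕ → Set ℓ
  HasOrder g n = 0 < n × power n g ≈ ε × (∀ m → 0 < m → power m g ≈ ε → n ≤ m)

  -- An element of infinite order has no m with HasOrder g m.
  OrderAtLeast : Carrier → ℕ → Set ℓ
  OrderAtLeast g n = ∀ m → HasOrder g m → n ≤ m

  HasElementOfOrderAtLeast : ℕ → Set (c ⊔ ℓ)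
  HasElementOfOrderAtLeast n = ∃ λ g → OrderAtLeast g n

  NoElementOfOrder4 : Set (c ⊔ ℓ)
  NoElementOfOrder4 = ∀ g → ¬ HasOrder g 4

  IsAbelian : Set (c ⊔ ℓ)
  IsAbelian = Commutative _∙_

  record IsSubgroup (A : Subset) : Set (c ⊔ ℓ) where
    field
      resp-≈    : A Respects _≈_
      ε-closed  : A ε
      ∙-closed  : ∀ {x y} → A x → A y → A (x ∙ y)
      ⁻¹-closed : ∀ {x} → A x → A (x ⁻¹)

  IsAbelianSubset : Subset → Set (c ⊔ ℓ)
  IsAbelianSubset A = ∀ {x y} → A x → A y → x ∙ y ≈ y ∙ x

  IsNormal : Subset → Set (c ⊔ ℓ)
  IsNormal A = ∀ g {a} → A a → A (g ∙ a ∙ g ⁻¹)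

  IsCharacteristic : Subset → Set (c ⊔ ℓ)
  IsCharacteristic A = ∀ φ → IsGroupIsomorphism φ → ∀ {a} → A a → A (φ a)

  -- r enumerates representatives of the left cosets: every x lies in r i ∙ A for
  -- exactly one i.
  HasIndex : Subset → ℕ → Set (c ⊔ ℓ)
  HasIndex A n = ∃ λ (r : Fin n → Carrier) → ∀ x → ∃! _≡_ λ i → A (r i ⁻¹ ∙ x)

  IsGeneralizedDicyclic : Set (suc (c ⊔ ℓ))
  IsGeneralizedDicyclic =
    ¬ IsAbelian ×
    ∃ λ A → IsSubgroup A × IsAbelianSubset A × IsNormal A × HasIndex A 2 ×
      ∃ λ x → ¬ A x × HasOrder x 4 × (∀ a → A a → x ∙ a ∙ x ⁻¹ ≈ a ⁻¹)

  NoNontrivialCharacteristicAbelianSubgroup : Set (suc (c ⊔ ℓ))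
  NoNontrivialCharacteristicAbelianSubgroup =
    ¬ ∃ λ A → IsSubgroup A × IsAbelianSubset A × IsCharacteristic A ×
      ∃ λ x → A x × ¬ x ≈ ε

{-# OPTIONS --safe #-}

-- Automorphisms of Cay(G, T) preserve the number of triangles on an edge.  Adding x = aᵏ,
-- s⁻¹x and their inverses to T, for a suitable power of an element a of large order,
-- creates a triangle on the edges labelled s and on no others labelled in T, except that
-- s² may be affected if s inverts x.  Repeating this at most 7 + i times for the i-th label
-- makes the counts of m given labels distinct and larger than those of the added elements,
-- at the cost of 2m² + 28m elements altogether.  Hence an automorphism f satisfies
-- f(gs) ∈ {f(g)s, f(g)s⁻¹} for all these labels s.
--
-- If the labels include s, t and st, then f(gs) = f(g)s⁻¹ ≠ f(g)s forces t to commute with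
-- s, to be inverted by s, or to satisfy t² = s⁻².  In a group that is neither abelian nor
-- generalized dicyclic, 6 labels per generator (3 under the hypotheses of part (2)) always
-- suffice to exclude this, so that f commutes with right multiplications by generators.

module Submission where

open import Algebra.Bundles using (Group)
open import Algebra.Morphism.Structures using (module GroupMorphisms)
import Algebra.Properties.Group
import Algebra.Properties.Monoid.Mult
open import Axiom.ExcludedMiddle using (ExcludedMiddle)
open import Data.Bool.Base using (Bool; true; false; not; if_then_else_)
open import Data.Fin.Base using (Fin; zero; suc)
import Data.Fin.Properties as Fin
open import Data.List.Base
  using (List; []; _∷_; _++_; length; map; concat; filter; deduplicate; upTo)
import Data.List.Membership.DecPropositional
import Data.List.Membership.Propositional.Properties as Membershipₚ
import Data.List.Membership.Setoid
import Data.List.Membership.Setoid.Properties as Membership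
open import Data.List.Properties
  using (length-++; length-map; filter-notAll; length-applyUpTo; length-filter;
    length-deduplicate)
open import Data.List.Relation.Unary.All as All using (All; []; _∷_)
import Data.List.Relation.Unary.All.Properties as All
open import Data.List.Relation.Unary.AllPairs as AllPairs using (AllPairs; []; _∷_)
import Data.List.Relation.Unary.AllPairs.Properties as AllPairs
open import Data.List.Relation.Unary.Any as Any using (Any; here; there)
import Data.List.Relation.Unary.Any.Properties as Any
import Data.List.Relation.Unary.Unique.DecSetoid.Properties as Unique
import Data.List.Relation.Unary.Unique.Setoid.Properties as Uniqueₛ
open import Data.Nat.Base using (_+_; _*_; ℕ; zero; suc; z≤n; s≤s; _≤_; _<_; _∸_; _^_)
open import Data.Nat.Induction using (<-rec)
import Data.Nat.Properties as ℕ
open import Data.Nat.Properties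
  using (≤-refl; +-mono-≤; *-suc; module ≤-Reasoning; ≤-trans; ≤-reflexive; ≤-antisym;
    +-monoʳ-≤; *-mono-≤; *-monoʳ-≤; *-identityʳ; m∸n≤m; m<n⇒0<n∸m; m+[n∸m]≡n; m∸n+n≡m;
    <⇒≤; ≮⇒≥; <-≤-trans; ≤-<-trans; +-mono-<; n≮n; +-monoˡ-≤; +-cancelʳ-≤; m≤m+n; m≤n+m;
    ≰⇒>; <-irrefl; *-monoˡ-≤; *-monoʳ-<; m≤n*m; ∸-monoˡ-≤; m≤n+m∸n)
open import Data.Nat.Tactic.RingSolver using (solve-∀)
open import Data.Product.Base using (_×_; _,_; ∃; proj₁; proj₂)
open import Data.Sum.Base using (_⊎_; inj₁; inj₂; [_,_]′)
open import Data.Vec.Base as Vec using (Vec; []; _∷_; lookup; allFin)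
open import Data.Vec.N-ary using (N-ary; _$ⁿ_)
open import Defs
open import Function.Base using (_∘_; case_of_)
open import Function.Bundles using (Equivalence; mk⇔)
open import Function.Definitions using (Congruent)
open import Level using (Level; _⊔_; Lift; lift; lower) renaming (suc to lsuc)
open import Relation.Binary.Bundles using (DecSetoid)
open import Relation.Binary.PropositionalEquality.Core as ≡ using (_≡_)
import Relation.Binary.PropositionalEquality.Properties as ≡
import Relation.Binary.Reasoning.Setoid
open import Relation.Nullary.Decidable.Core using (yes; no; Dec; map′; decidable-stable; ¬?)
open import Relation.Nullary.Negation.Core using (¬_; contradiction)
open import Relation.Unary using (Pred; _⊆_)

-- The obstacle is that the new elements also create triangles on edges labelled by products of two
-- of them. The products x² and s⁻¹x² can always be kept out of T, but x⁻¹s⁻¹x, x s⁻¹x and (s⁻¹x)²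
-- behave differently according to whether s inverts or centralizes a power of a, or does neither;
-- this forces three cases in the choice of x.
--
-- If s inverts x, the damage to s² is harmless as long as s² is treated after s. Such an order
-- exists because s² then centralizes a power of a, and could invert another one only if a had small
-- order.
--
-- If T has at most n elements, the values that x must avoid number about 2n², so that x is sought
-- among K powers with K slightly above this. Squares of powers of a small power of a occur, so that
-- the first 2K² powers of a must be nontrivial, and F(n) exceeds 2K² for n ≥ 4. Since T has reached
-- at most its final size minus 4 before its last extension, n may be four less than the bound on
-- the valency.

-- Equations in groups by free reduction

module FreeGroupSolver {c ℓ} (G : Group c ℓ) where
  open Group G
  open Algebra.Properties.Group G
  open Relation.Binary.Reasoning.Setoid setoid

  infixl 7 _⊕_
  infix  8 ⊝_

  data Expr (n : ℕ) : Set where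
    var : Fin n → Expr n
    :ε  : Expr n
    _⊕_ : Expr n → Expr n → Expr n
    ⊝_  : Expr n → Expr n

  private
    variable
      n : ℕ

    Word : ℕ → Set
    Word n = List (Bool × Fin n)

    ⟦_⟧ : Expr n → Vec Carrier n → Carrier
    ⟦ var i ⟧ ρ = lookup ρ i
    ⟦ :ε ⟧    ρ = ε
    ⟦ e ⊕ f ⟧ ρ = ⟦ e ⟧ ρ ∙ ⟦ f ⟧ ρ
    ⟦ ⊝ e ⟧   ρ = ⟦ e ⟧ ρ ⁻¹

    signed : Bool → Carrier → Carrier
    signed true  x = x
    signed false x = x ⁻¹

    ⟦_⟧ʷ : Word n → Vec Carrier n → Carrier
    ⟦ [] ⟧ʷ          ρ = ε
    ⟦ (b , i) ∷ w ⟧ʷ ρ = signed b (lookup ρ i) ∙ ⟦ w ⟧ʷ ρ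

    opposite : Bool → Bool → Bool
    opposite true  b = not b
    opposite false b = b

    push : Bool → Fin n → Word n → Word n
    push b i []            = (b , i) ∷ []
    push b i ((d , j) ∷ w) with i Fin.≟ j
    ... | no  _ = (b , i) ∷ (d , j) ∷ w
    ... | yes _ = if opposite b d then w else (b , i) ∷ (d , j) ∷ w

    push-correct : ∀ b (i : Fin n) w ρ → ⟦ push b i w ⟧ʷ ρ ≈ signed b (lookup ρ i) ∙ ⟦ w ⟧ʷ ρ
    push-correct b i []            ρ = refl
    push-correct b i ((d , j) ∷ w) ρ with i Fin.≟ j
    ... | no  _ = refl
    push-correct true  i ((true  , j) ∷ w) ρ | yes ≡.refl = refl
    push-correct true  i ((false , j) ∷ w) ρ | yes ≡.refl = sym (\\-leftDividesˡ _ _)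
    push-correct false i ((true  , j) ∷ w) ρ | yes ≡.refl = sym (\\-leftDividesʳ _ _)
    push-correct false i ((false , j) ∷ w) ρ | yes ≡.refl = refl

    -- The flag carries a pending inversion and the word is an accumulator, so that words are never
    -- concatenated or inverted.
    norm : Bool → Expr n → Word n → Word n
    norm b     (var i) w = push b i w
    norm b     :ε      w = w
    norm true  (e ⊕ f) w = norm true e (norm true f w)
    norm false (e ⊕ f) w = norm false f (norm false e w)
    norm b     (⊝ e)   w = norm (not b) e w

    norm-correct : ∀ b (e : Expr n) w ρ → ⟦ norm b e w ⟧ʷ ρ ≈ signed b (⟦ e ⟧ ρ) ∙ ⟦ w ⟧ʷ ρ
    norm-correct b     (var i) w ρ = push-correct b i w ρ
    norm-correct true  :ε      w ρ = sym (identityˡ _)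
    norm-correct false :ε      w ρ = sym (trans (∙-congʳ ε⁻¹≈ε) (identityˡ _))
    norm-correct true  (e ⊕ f) w ρ =
      trans (norm-correct true e _ ρ) (trans (∙-congˡ (norm-correct true f w ρ)) (sym (assoc _ _ _)))
    norm-correct false (e ⊕ f) w ρ =
      trans (norm-correct false f _ ρ) (trans (∙-congˡ (norm-correct false e w ρ))
        (trans (sym (assoc _ _ _)) (∙-congʳ (sym (⁻¹-anti-homo-∙ _ _)))))
    norm-correct true  (⊝ e)   w ρ = norm-correct false e w ρ
    norm-correct false (⊝ e)   w ρ =
      trans (norm-correct true e w ρ) (∙-congʳ (sym (⁻¹-involutive _)))

  infix  5 _⊜_
  infix  4 _◂_
  infixr 3 _&_
  infix  2 _⟸_

  Equation : ℕ → Set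
  Equation n = Expr n × Expr n

  _⊜_ : Expr n → Expr n → Equation n
  _⊜_ = _,_

  Hypotheses : ℕ → Set
  Hypotheses n = List (Expr n × Equation n)

  _⟸_ : Equation n → Hypotheses n → Equation n × Hypotheses n
  _⟸_ = _,_

  _◂_ : Expr n → Equation n → Hypotheses n
  a ◂ h = (a , h) ∷ []

  _&_ : Hypotheses n → Hypotheses n → Hypotheses n
  _&_ = _++_

  private
    -- An equation l ≈ r stands for the relator l r⁻¹.
    relators : Hypotheses n → Expr n
    relators []                 = :ε
    relators ((a , l , r) ∷ hs) = (a ⊕ (l ⊕ ⊝ r) ⊕ ⊝ a) ⊕ relators hs

    Holds : Equation n → Vec Carrier n → Set ℓ
    Holds (l , r) ρ = ⟦ l ⟧ ρ ≈ ⟦ r ⟧ ρ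

    Implies : Hypotheses n → Set ℓ → Vec Carrier n → Set ℓ
    Implies []             A ρ = A
    Implies ((_ , h) ∷ hs) A ρ = Holds h ρ → Implies hs A ρ

    implies : ∀ (hs : Hypotheses n) {A : Set ℓ} ρ → (⟦ relators hs ⟧ ρ ≈ ε → A) → Implies hs A ρ
    implies []                 ρ k = k refl
    implies ((a , l , r) ∷ hs) ρ k l≈r = implies hs ρ λ rest → k (begin
      ⟦ a ⟧ ρ ∙ (⟦ l ⟧ ρ ∙ ⟦ r ⟧ ρ ⁻¹) ∙ ⟦ a ⟧ ρ ⁻¹ ∙ ⟦ relators hs ⟧ ρ
        ≈⟨ ∙-cong (∙-congʳ (∙-congˡ (x≈y⇒x∙y⁻¹≈ε l≈r))) rest ⟩
      ⟦ a ⟧ ρ ∙ ε ∙ ⟦ a ⟧ ρ ⁻¹ ∙ ε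
        ≈⟨ identityʳ _ ⟩
      ⟦ a ⟧ ρ ∙ ε ∙ ⟦ a ⟧ ρ ⁻¹
        ≈⟨ ∙-congʳ (identityʳ _) ⟩
      ⟦ a ⟧ ρ ∙ ⟦ a ⟧ ρ ⁻¹
        ≈⟨ inverseʳ _ ⟩
      ε ∎)

    -- For closed expressions both words evaluate, which is why `≡.refl` serves as the proof
    -- wherever `deduce` is applied.
    Deducible : Equation n × Hypotheses n → Set
    Deducible ((p , q) , hs) = norm true (p ⊕ ⊝ q) [] ≡ norm true (relators hs) []

    Deduction : Equation n × Hypotheses n → Vec Carrier n → Set ℓ
    Deduction (goal , hs) ρ = Implies hs (Holds goal ρ) ρ

    close : ∀ {a} {A : Set a} n → N-ary n (Expr n) A → A
    close n f = f $ⁿ Vec.map var (allFin n)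

  -- An equation follows from others if its relator is freely equal to a product of
  -- conjugates of theirs; the conjugators are the left arguments of _◂_.
  deduce : ∀ n (f : N-ary n (Expr n) (Equation n × Hypotheses n)) →
           Deducible (close n f) → (ρ : Vec Carrier n) → Deduction (close n f) ρ
  deduce n f eq ρ = let ((p , q) , hs) = close n f in
    implies hs ρ λ rest → x∙y⁻¹≈ε⇒x≈y _ _ (begin
      ⟦ p ⊕ ⊝ q ⟧ ρ                        ≈⟨ trans (norm-correct true (p ⊕ ⊝ q) [] ρ) (identityʳ _) ⟨
      ⟦ norm true (p ⊕ ⊝ q) [] ⟧ʷ ρ        ≡⟨ ≡.cong (λ w → ⟦ w ⟧ʷ ρ) eq ⟩
      ⟦ norm true (relators hs) [] ⟧ʷ ρ    ≈⟨ trans (norm-correct true (relators hs) [] ρ) (identityʳ _) ⟩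
      ⟦ relators hs ⟧ ρ                    ≈⟨ rest ⟩
      ε                                    ∎)

-- Maps that preserve labels up to inversion

module Rigidity {c ℓ} (G : Group c ℓ) {f : Group.Carrier G → Group.Carrier G}
                (f-cong : Congruent (Group._≈_ G) (Group._≈_ G) f) where
  open Group G
  open Algebra.Properties.Group G
  open FreeGroupSolver G

  -- No more can be expected from triangle counts, which agree on an element and its inverse.
  PreservesColour : Carrier → Set (c ⊔ ℓ)
  PreservesColour s = ∀ g → f (g ∙ s) ≈ f g ∙ s ⊎ f (g ∙ s) ≈ f g ∙ s ⁻¹

  -- If this holds for every s, then f is left multiplication by `f ε`.
  CommutesWith : Carrier → Set (c ⊔ ℓ)
  CommutesWith s = ∀ g → f (g ∙ s) ≈ f g ∙ s

  commutesWith-resp : ∀ {s t} → s ≈ t → CommutesWith s → CommutesWith t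
  commutesWith-resp s≈t p g = trans (f-cong (∙-congˡ (sym s≈t))) (trans (p g) (∙-congˡ s≈t))

  commutesWith-ε : CommutesWith ε
  commutesWith-ε g = trans (f-cong (identityʳ g)) (sym (identityʳ (f g)))

  commutesWith-∙ : ∀ {s t} → CommutesWith s → CommutesWith t → CommutesWith (s ∙ t)
  commutesWith-∙ p q g =
    trans (f-cong (sym (assoc _ _ _))) (trans (q _) (trans (∙-congʳ (p g)) (assoc _ _ _)))

  commutesWith-⁻¹ : ∀ {s} → CommutesWith s → CommutesWith (s ⁻¹)
  commutesWith-⁻¹ {s} p g = sym (trans (∙-congʳ (trans (f-cong (sym (//-rightDividesˡ s g))) (p _)))
    (//-rightDividesʳ s _))

  generated : ∀ {S} → (∀ {s} → S s → CommutesWith s) → ∀ {x} → Generated G S x → CommutesWith x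
  generated p (gen s)      = p s
  generated p unit         = commutesWith-ε
  generated p (mul x y)    = commutesWith-∙ (generated p x) (generated p y)
  generated p (inv x)      = commutesWith-⁻¹ (generated p x)
  generated p (resp x≈y x) = commutesWith-resp x≈y (generated p x)

  private
    -- F, P and Q are the images of the vertices of a triangle; w, v and x are the labels of its
    -- edges from F to P, from P to Q and from F to Q.
    compare : ∀ {P Q F v w x} → Q ≈ P ∙ v → P ≈ F ∙ w → Q ≈ F ∙ x → w ∙ v ≈ x
    compare Q≈ P≈ Q≈′ = ∙-cancelˡ _ _ _
      (trans (sym (assoc _ _ _)) (trans (∙-congʳ (sym P≈)) (trans (sym Q≈) Q≈′)))

    split : ∀ {u g} → CommutesWith u → f g ≈ f (g ∙ u ⁻¹) ∙ u
    split {u} {g} pu = trans (f-cong (sym (//-rightDividesˡ u g))) (pu _)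

    regroup : ∀ {g u s} → f (g ∙ s) ≈ f (g ∙ u ⁻¹ ∙ (u ∙ s))
    regroup {g} {u} = f-cong (trans (∙-congʳ (sym (//-rightDividesˡ u g))) (assoc _ _ _))

  involution-rule : ∀ {s} → PreservesColour s → s ∙ s ≈ ε → CommutesWith s
  involution-rule p ss g with p g
  ... | inj₁ q = q
  ... | inj₂ q = trans q (∙-congˡ (sym (inverseˡ-unique _ _ ss)))

  -- If f reverses s at g, then the triangle g, gs, gst has an image with labels s⁻¹, t or t⁻¹, and
  -- st or its inverse. One choice of signs gives s⁻¹ = s, and the other three are the excluded
  -- equations.
  triangle-rule : ∀ {s t} → PreservesColour s → PreservesColour t → PreservesColour (s ∙ t) →
                  ¬ s ∙ t ≈ t ∙ s → ¬ s ∙ t ≈ t ⁻¹ ∙ s → ¬ s ∙ s ≈ t ⁻¹ ∙ t ⁻¹ → CommutesWith s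
  triangle-rule {s} {t} ps pt pst c₁ c₂ c₃ g with ps g
  ... | inj₁ q = q
  ... | inj₂ q with pt (g ∙ s) | pst g
  ...   | inj₁ r | inj₁ r′ = trans q (∙-congˡ (∙-cancelʳ _ _ _ (compare r q (trans (f-cong (assoc _ _ _)) r′))))
  ...   | inj₁ r | inj₂ r′ = contradiction (deduce 2 (λ s t → s ⊕ t ⊜ ⊝ t ⊕ s ⟸ ⊝ t ⊕ s ◂ ⊝ s ⊕ t ⊜ ⊝ (s ⊕ t))
                               ≡.refl (s ∷ t ∷ []) (compare r q (trans (f-cong (assoc _ _ _)) r′))) c₂
  ...   | inj₂ r | inj₁ r′ = contradiction (deduce 2 (λ s t → s ⊕ s ⊜ ⊝ t ⊕ ⊝ t ⟸ s ◂ s ⊕ t ⊜ ⊝ s ⊕ ⊝ t)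
                               ≡.refl (s ∷ t ∷ []) (sym (compare r q (trans (f-cong (assoc _ _ _)) r′)))) c₃
  ...   | inj₂ r | inj₂ r′ = contradiction (deduce 2 (λ s t → s ⊕ t ⊜ t ⊕ s ⟸ s ⊕ t ◂ ⊝ s ⊕ ⊝ t ⊜ ⊝ (s ⊕ t))
                               ≡.refl (s ∷ t ∷ []) (compare r q (trans (f-cong (assoc _ _ _)) r′))) c₁

  -- In the triangle gu⁻¹, g, gs the first edge keeps its label, so that reversing s leaves only
  -- us⁻¹ = us, which is harmless, and us⁻¹ = (us)⁻¹, which says that s inverts u.
  product-rule : ∀ {u s} → CommutesWith u → PreservesColour s → PreservesColour (u ∙ s) →
                 ¬ s ∙ u ≈ u ⁻¹ ∙ s → CommutesWith s
  product-rule {u} {s} pu ps pus c g with ps g | pus (g ∙ u ⁻¹)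
  ... | inj₁ q | _      = q
  ... | inj₂ q | inj₁ r = trans q (∙-congˡ (∙-cancelˡ _ _ _ (compare q (split pu) (trans regroup r))))
  ... | inj₂ q | inj₂ r = contradiction (deduce 2 (λ s u → s ⊕ u ⊜ ⊝ u ⊕ s ⟸ s ◂ u ⊕ ⊝ s ⊜ ⊝ (u ⊕ s))
                            ≡.refl (s ∷ u ∷ []) (compare q (split pu) (trans regroup r))) c

-- Recognizing generalized dicyclic groups

module Dicyclic {c ℓ} (em : ExcludedMiddle (lsuc (c ⊔ ℓ))) (G : Group c ℓ) where
  open Group G
  open Algebra.Properties.Group G
  open FreeGroupSolver G

  lem : {P : Set (c ⊔ ℓ)} → Dec P
  lem {P} = map′ lower lift (em {Lift (lsuc (c ⊔ ℓ)) P})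

  _≟_ : ∀ x y → Dec (x ≈ y)
  x ≟ y = map′ lower lift (lem {Lift c (x ≈ y)})

  by-contradiction : {P : Set (c ⊔ ℓ)} → ¬ ¬ P → P
  by-contradiction = decidable-stable lem

  -- The first hypothesis is x⁴ = ε in the form in which it arises. Together with x³ = ε it would
  -- give x² = x⁶x⁻⁴ = ε.
  order-4 : ∀ {x} → x ∙ x ≈ x ⁻¹ ∙ x ⁻¹ → ¬ x ∙ x ≈ ε → HasOrder G x 4
  order-4 {x} x⁴ x² = s≤s z≤n
    , deduce 1 (λ x → x ⊕ (x ⊕ (x ⊕ (x ⊕ :ε))) ⊜ :ε ⟸ :ε ◂ x ⊕ x ⊜ ⊝ x ⊕ ⊝ x) ≡.refl (x ∷ []) x⁴
    , λ where
        1 _ h → contradiction (deduce 1 (λ x → x ⊕ x ⊜ :ε ⟸ :ε ◂ x ⊕ :ε ⊜ :ε & :ε ◂ x ⊕ :ε ⊜ :ε)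
                  ≡.refl (x ∷ []) h h) x²
        2 _ h → contradiction (trans (∙-congˡ (sym (identityʳ x))) h) x²
        3 _ h → contradiction (deduce 1 (λ x → x ⊕ x ⊜ :ε ⟸
                  :ε ◂ x ⊕ (x ⊕ (x ⊕ :ε)) ⊜ :ε & :ε ◂ x ⊕ (x ⊕ (x ⊕ :ε)) ⊜ :ε & :ε ◂ ⊝ x ⊕ ⊝ x ⊜ x ⊕ x)
                  ≡.refl (x ∷ []) h h (sym x⁴)) x²
        (suc (suc (suc (suc m)))) _ _ → s≤s (s≤s (s≤s (s≤s z≤n)))

  -- The abelian subgroup of index 2 is the centralizer of u.
  dicyclic : ∀ {u x} → ¬ u ∙ u ≈ ε → ¬ x ∙ x ≈ ε →
             (∀ g → g ∙ u ≈ u ∙ g ⊎ g ∙ u ≈ u ⁻¹ ∙ g) →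
             (∀ a → a ∙ u ≈ u ∙ a → x ∙ a ≈ a ⁻¹ ∙ x) → IsGeneralizedDicyclic G
  dicyclic {u} {x} u² x² dichotomy inverts =
      (λ ab → x-∉ (ab x u))
    , (λ a → Lift c (a ∙ u ≈ u ∙ a))
    , record
        { resp-≈    = λ a≈b (lift p) → lift (trans (∙-congʳ (sym a≈b)) (trans p (∙-congˡ a≈b)))
        ; ε-closed  = lift (trans (identityˡ u) (sym (identityʳ u)))
        ; ∙-closed  = λ {a} {b} (lift p) (lift q) → lift (closed a b p q)
        ; ⁻¹-closed = λ {a} (lift p) → lift (deduce 2 (λ a u → ⊝ a ⊕ u ⊜ u ⊕ ⊝ a ⟸ ⊝ a ◂ u ⊕ a ⊜ a ⊕ u)
                        ≡.refl (a ∷ u ∷ []) (sym p))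
        }
    -- Conjugation by x inverts a, b and ab, so that inversion is multiplicative on the centralizer.
    , (λ {a} {b} (lift p) (lift q) →
        deduce 3 (λ a b x → a ⊕ b ⊜ b ⊕ a ⟸ ⊝ x ◂ x ⊕ (a ⊕ b) ⊜ ⊝ (a ⊕ b) ⊕ x
          & ⊝ x ⊕ ⊝ b ◂ ⊝ a ⊕ x ⊜ x ⊕ a & ⊝ x ◂ ⊝ b ⊕ x ⊜ x ⊕ b)
          ≡.refl (a ∷ b ∷ x ∷ []) (inverts _ (closed a b p q)) (sym (inverts a p)) (sym (inverts b q)))
    , (λ g {a} (lift p) → lift (normal g a p))
    , (index , cosets)
    , x , (λ (lift p) → x-∉ p)
    -- As x² centralizes u, it is inverted by x, with which it also commutes; hence x⁴ = ε.
    , order-4 (inverts-x² (inverts _ xx-∈)) x²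
    , (λ a (lift p) → trans (∙-congʳ (inverts a p)) (//-rightDividesʳ x _))
    where
    xu : x ∙ u ≈ u ⁻¹ ∙ x
    xu = inverts u refl

    x-∉ : ¬ x ∙ u ≈ u ∙ x
    x-∉ p = u² (deduce 2 (λ x u → u ⊕ u ⊜ :ε ⟸ u ◂ u ⊕ x ⊜ x ⊕ u & u ◂ x ⊕ u ⊜ ⊝ u ⊕ x)
      ≡.refl (x ∷ u ∷ []) (sym p) xu)

    closed : ∀ a b → a ∙ u ≈ u ∙ a → b ∙ u ≈ u ∙ b → a ∙ b ∙ u ≈ u ∙ (a ∙ b)
    closed a b p q = deduce 3 (λ a b u → a ⊕ b ⊕ u ⊜ u ⊕ (a ⊕ b) ⟸ a ◂ b ⊕ u ⊜ u ⊕ b & :ε ◂ a ⊕ u ⊜ u ⊕ a)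
      ≡.refl (a ∷ b ∷ u ∷ []) q p

    xx-∈ : x ∙ x ∙ u ≈ u ∙ (x ∙ x)
    xx-∈ = deduce 2 (λ x u → x ⊕ x ⊕ u ⊜ u ⊕ (x ⊕ x) ⟸ x ◂ x ⊕ u ⊜ ⊝ u ⊕ x & :ε ◂ x ⊕ ⊝ u ⊜ u ⊕ x)
      ≡.refl (x ∷ u ∷ []) xu (deduce 2 (λ x u → x ⊕ ⊝ u ⊜ u ⊕ x ⟸ u ◂ ⊝ u ⊕ x ⊜ x ⊕ u)
      ≡.refl (x ∷ u ∷ []) (sym xu))

    inverts-x² : x ∙ (x ∙ x) ≈ (x ∙ x) ⁻¹ ∙ x → x ∙ x ≈ x ⁻¹ ∙ x ⁻¹
    inverts-x² h = deduce 1 (λ x → x ⊕ x ⊜ ⊝ x ⊕ ⊝ x ⟸ :ε ◂ x ⊕ (x ⊕ x) ⊜ ⊝ (x ⊕ x) ⊕ x) ≡.refl (x ∷ []) h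

    normal : ∀ g a → a ∙ u ≈ u ∙ a → g ∙ a ∙ g ⁻¹ ∙ u ≈ u ∙ (g ∙ a ∙ g ⁻¹)
    normal g a p with dichotomy g
    ... | inj₁ q = deduce 3 (λ g a u → g ⊕ a ⊕ ⊝ g ⊕ u ⊜ u ⊕ (g ⊕ a ⊕ ⊝ g) ⟸
                     g ⊕ a ⊕ ⊝ g ◂ u ⊕ g ⊜ g ⊕ u & g ◂ a ⊕ u ⊜ u ⊕ a & :ε ◂ g ⊕ u ⊜ u ⊕ g)
                     ≡.refl (g ∷ a ∷ u ∷ []) (sym q) p q
    ... | inj₂ q = deduce 3 (λ g a u → g ⊕ a ⊕ ⊝ g ⊕ u ⊜ u ⊕ (g ⊕ a ⊕ ⊝ g) ⟸
                     (g ⊕ a ⊕ ⊝ g ⊕ u) ◂ g ⊕ u ⊜ ⊝ u ⊕ g & g ⊕ ⊝ u ◂ u ⊕ a ⊜ a ⊕ u & u ◂ ⊝ u ⊕ g ⊜ g ⊕ u)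
                     ≡.refl (g ∷ a ∷ u ∷ []) q (sym p) (sym q)

    index : Fin 2 → Carrier
    index zero       = ε
    index (suc zero) = x

    trivial : ∀ {g} → ε ⁻¹ ∙ g ≈ g
    trivial = trans (∙-congʳ ε⁻¹≈ε) (identityˡ _)

    -- Both g and x invert u, so their quotient centralizes it. With the dichotomy this leaves only
    -- two cosets.
    x⁻¹-coset : ∀ g → g ∙ u ≈ u ⁻¹ ∙ g → x ⁻¹ ∙ g ∙ u ≈ u ∙ (x ⁻¹ ∙ g)
    x⁻¹-coset g gu = deduce 3 (λ g x u → ⊝ x ⊕ g ⊕ u ⊜ u ⊕ (⊝ x ⊕ g) ⟸
      ⊝ x ◂ g ⊕ u ⊜ ⊝ u ⊕ g & ⊝ x ◂ ⊝ u ⊕ x ⊜ x ⊕ u) ≡.refl (g ∷ x ∷ u ∷ []) gu (sym xu)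

    not-both : ∀ g → g ∙ u ≈ u ∙ g → ¬ x ⁻¹ ∙ g ∙ u ≈ u ∙ (x ⁻¹ ∙ g)
    not-both g p q = x-∉ (deduce 3 (λ g x u → x ⊕ u ⊜ u ⊕ x ⟸
      x ◂ u ⊕ (⊝ x ⊕ g) ⊜ ⊝ x ⊕ g ⊕ u & :ε ◂ g ⊕ u ⊜ u ⊕ g) ≡.refl (g ∷ x ∷ u ∷ []) (sym q) p)

    InCoset : Carrier → Fin 2 → Set (c ⊔ ℓ)
    InCoset g i = Lift c (index i ⁻¹ ∙ g ∙ u ≈ u ∙ (index i ⁻¹ ∙ g))

    unique-zero : ∀ g → g ∙ u ≈ u ∙ g → ∀ j → InCoset g j → zero ≡ j
    unique-zero g p zero       _        = ≡.refl
    unique-zero g p (suc zero) (lift q) = contradiction q (not-both g p)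

    unique-one : ∀ g → ¬ g ∙ u ≈ u ∙ g → ∀ j → InCoset g j → suc zero ≡ j
    unique-one g ¬p zero       (lift q) = contradiction (trans (∙-congʳ (sym trivial)) (trans q (∙-congˡ trivial))) ¬p
    unique-one g ¬p (suc zero) _        = ≡.refl

    cosets : ∀ g → ∃ λ i → InCoset g i × (∀ {j} → InCoset g j → i ≡ j)
    cosets g = case (g ∙ u) ≟ (u ∙ g) of λ where
      (yes p) → zero , lift (trans (∙-congʳ trivial) (trans p (∙-congˡ (sym trivial)))) , λ {j} → unique-zero g p j
      (no ¬p) → suc zero , lift (x⁻¹-coset g ([ (λ p → contradiction p ¬p) , (λ q → q) ]′ (dichotomy g)))
                  , λ {j} → unique-one g ¬p j

-- Labels that determine the generators

module Colours {c ℓ} (em : ExcludedMiddle (lsuc (c ⊔ ℓ))) (G : Group c ℓ) where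
  open Group G
  open Algebra.Properties.Group G
  open Data.List.Membership.Setoid setoid using (_∈_)
  open FreeGroupSolver G
  open Dicyclic em G
  open GroupMorphisms rawGroup rawGroup using (module IsGroupIsomorphism; IsGroupIsomorphism)

  Central : Carrier → Set (c ⊔ ℓ)
  Central s = ∀ t → s ∙ t ≈ t ∙ s

  noncentral : ∀ {s} → ¬ Central s → ∃ λ t → ¬ s ∙ t ≈ t ∙ s
  noncentral {s} nc = by-contradiction λ none → nc λ t → case (s ∙ t) ≟ (t ∙ s) of λ where
    (yes p) → p
    (no ¬p) → contradiction (t , ¬p) none

  -- The quantifier ranges over all maps, not only over automorphisms, because the labels are chosen
  -- before there is a graph.
  Determines : List Carrier → Carrier → Set (c ⊔ ℓ)
  Determines L s = ∀ f (f-cong : Congruent _≈_ _≈_ f) → let open Rigidity G f-cong in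
    All PreservesColour L → CommutesWith s

  involution-colours : ∀ {s} → s ∙ s ≈ ε → Determines (s ∷ []) s
  involution-colours ss _ f-cong (ps ∷ []) = Rigidity.involution-rule G f-cong ps ss

  triangle-colours : ∀ {s t} → ¬ s ∙ t ≈ t ∙ s → ¬ s ∙ t ≈ t ⁻¹ ∙ s → ¬ s ∙ s ≈ t ⁻¹ ∙ t ⁻¹ →
                     Determines (s ∷ t ∷ s ∙ t ∷ []) s
  triangle-colours c₁ c₂ c₃ _ f-cong (ps ∷ pt ∷ pst ∷ []) =
    Rigidity.triangle-rule G f-cong ps pt pst c₁ c₂ c₃

  -- The triangle rule may be tried with t⁻¹ in place of t. The first two exceptions are the same
  -- for both, but the third one becomes s² = t², so that both attempts fail only if s² equals t²
  -- and t⁻².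
  triangle-colours± : ∀ {s t} → ¬ s ∙ t ≈ t ∙ s → ¬ s ∙ t ≈ t ⁻¹ ∙ s →
                      (∃ λ L → length L ≤ 2 × Determines (s ∷ L) s) ⊎
                      (s ∙ s ≈ t ⁻¹ ∙ t ⁻¹ × s ∙ s ≈ t ∙ t)
  triangle-colours± {s} {t} st st′ with (s ∙ s) ≟ (t ⁻¹ ∙ t ⁻¹) | (s ∙ s) ≟ (t ∙ t)
  ... | yes p | yes q = inj₂ (p , q)
  ... | no ¬p | _     = inj₁ (t ∷ s ∙ t ∷ [] , s≤s (s≤s z≤n) , triangle-colours st st′ ¬p)
  ... | yes _ | no ¬q = inj₁ (t ⁻¹ ∷ s ∙ t ⁻¹ ∷ [] , s≤s (s≤s z≤n) , triangle-colours
    (λ r → st (deduce 2 (λ s t → s ⊕ t ⊜ t ⊕ s ⟸ t ◂ ⊝ t ⊕ s ⊜ s ⊕ ⊝ t) ≡.refl (s ∷ t ∷ []) (sym r)))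
    (λ r → st′ (deduce 2 (λ s t → s ⊕ t ⊜ ⊝ t ⊕ s ⟸ ⊝ t ◂ ⊝ (⊝ t) ⊕ s ⊜ s ⊕ ⊝ t) ≡.refl (s ∷ t ∷ []) (sym r)))
    (λ r → ¬q (trans r (∙-cong (⁻¹-involutive t) (⁻¹-involutive t)))))

  module _ (nondicyclic : ¬ IsGeneralizedDicyclic G) where

    -- Otherwise each t commutes with s or is inverted by s. Let t not commute with s, and let a do
    -- so. Then ta does not commute with s either, so s inverts both t and ta, whence t inverts a.
    -- Thus t inverts the whole centralizer of s, and G is generalized dicyclic.
    neither : ∀ {s} → ¬ Central s → ¬ s ∙ s ≈ ε → ∃ λ t → ¬ s ∙ t ≈ t ∙ s × ¬ s ∙ t ≈ t ⁻¹ ∙ s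
    neither {s} nc s² = by-contradiction λ none →
      let
        t₀ , st₀ = noncentral nc

        either : ∀ t → s ∙ t ≈ t ∙ s ⊎ s ∙ t ≈ t ⁻¹ ∙ s
        either t = case (s ∙ t) ≟ (t ∙ s) of λ where
          (yes p) → inj₁ p
          (no ¬p) → case (s ∙ t) ≟ (t ⁻¹ ∙ s) of λ where
            (yes q) → inj₂ q
            (no ¬q) → contradiction (t , ¬p , ¬q) none

        inverted : ∀ {t} → ¬ s ∙ t ≈ t ∙ s → s ∙ t ≈ t ⁻¹ ∙ s
        inverted {t} ¬p = [ (λ p → contradiction p ¬p) , (λ q → q) ]′ (either t)

        inverts : ∀ {t} → ¬ s ∙ t ≈ t ∙ s → ∀ a → a ∙ s ≈ s ∙ a → t ∙ a ≈ a ⁻¹ ∙ t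
        inverts {t} ¬p a as = case either (t ∙ a) of λ where
          (inj₁ p) → contradiction (deduce 3 (λ s t a → s ⊕ t ⊜ t ⊕ s ⟸
                       :ε ◂ s ⊕ (t ⊕ a) ⊜ t ⊕ a ⊕ s & t ◂ a ⊕ s ⊜ s ⊕ a)
                       ≡.refl (s ∷ t ∷ a ∷ []) p as) ¬p
          (inj₂ p) → deduce 3 (λ s t a → t ⊕ a ⊜ ⊝ a ⊕ t ⟸
                       t ⊕ a ⊕ ⊝ t ◂ a ⊕ s ⊜ s ⊕ a & t ⊕ a ◂ ⊝ t ⊕ s ⊜ s ⊕ t & t ⊕ a ◂ s ⊕ (t ⊕ a) ⊜ ⊝ (t ⊕ a) ⊕ s)
                       ≡.refl (s ∷ t ∷ a ∷ []) as (sym (inverted ¬p)) p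
      in nondicyclic (dicyclic {s} {t₀} s²
           (λ t₀² → st₀ (trans (inverted st₀) (∙-congʳ (sym (inverseˡ-unique _ _ t₀²)))))
           (λ g → case (s ∙ g) ≟ (g ∙ s) of λ where
             (yes p) → inj₁ (sym p)
             (no ¬p) → inj₂ (inverts ¬p s refl))
           (inverts st₀))

    -- Otherwise s inverts every element that does not invert u. If g is such an element, then so is
    -- ug; as s inverts u, g and ug, the elements u and g commute. Hence each g centralizes or
    -- inverts u, and s inverts the centralizer of u, so that G is generalized dicyclic.
    inverting-neither : ∀ {s u} → ¬ s ∙ s ≈ ε → ¬ u ∙ u ≈ ε → s ∙ u ≈ u ⁻¹ ∙ s →
                        ∃ λ h → ¬ h ∙ u ≈ u ⁻¹ ∙ h × ¬ s ∙ h ≈ h ⁻¹ ∙ s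
    inverting-neither {s} {u} s² u² su = by-contradiction λ none →
      let
        inverted : ∀ {h} → ¬ h ∙ u ≈ u ⁻¹ ∙ h → s ∙ h ≈ h ⁻¹ ∙ s
        inverted {h} ¬p = case (s ∙ h) ≟ (h ⁻¹ ∙ s) of λ where
          (yes q) → q
          (no ¬q) → contradiction (h , ¬p , ¬q) none
      in nondicyclic (dicyclic {u} {s} u² s²
           (λ g → case (g ∙ u) ≟ (u ⁻¹ ∙ g) of λ where
             (yes p) → inj₂ p
             (no ¬p) → inj₁ (deduce 3 (λ s u g → g ⊕ u ⊜ u ⊕ g ⟸
                 g ⊕ u ◂ ⊝ (u ⊕ g) ⊕ s ⊜ s ⊕ (u ⊕ g) & g ⊕ u ◂ s ⊕ u ⊜ ⊝ u ⊕ s & g ◂ s ⊕ g ⊜ ⊝ g ⊕ s)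
                 ≡.refl (s ∷ u ∷ g ∷ [])
                 (sym (inverted (λ q → ¬p (deduce 2 (λ u g → g ⊕ u ⊜ ⊝ u ⊕ g ⟸ ⊝ u ◂ u ⊕ g ⊕ u ⊜ ⊝ u ⊕ (u ⊕ g))
                   ≡.refl (u ∷ g ∷ []) q))))
                 su (inverted ¬p)))
           (λ a au → inverted λ p → u² (deduce 2 (λ u a → u ⊕ u ⊜ :ε ⟸ u ◂ u ⊕ a ⊜ a ⊕ u & u ◂ a ⊕ u ⊜ ⊝ u ⊕ a)
             ≡.refl (u ∷ a ∷ []) (sym au) p)))

    -- Although s inverts u = s t, which the triangle rule determines from s and u s, there
    -- is an h that does not invert u and is not inverted by s, and the product rule leads
    -- from u to h and from h to s.
    equal-squares-colours : ∀ {s t} → ¬ s ∙ s ≈ ε → ¬ s ∙ t ≈ t ∙ s → ¬ s ∙ t ≈ t ⁻¹ ∙ s →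
                            s ∙ s ≈ t ⁻¹ ∙ t ⁻¹ → s ∙ s ≈ t ∙ t →
                            ∃ λ L → length L ≤ 5 × Determines (s ∷ L) s
    equal-squares-colours {s} {t} s² st st′ p q =
      u ∷ u ∙ s ∷ h ∷ u ∙ h ∷ h ∙ s ∷ [] , ≤-refl , λ where
        _ f-cong (ps ∷ pu ∷ pus ∷ ph ∷ puh ∷ phs ∷ []) → let open Rigidity G f-cong in
          product-rule (product-rule (triangle-rule pu ps pus us us′ uu) ph puh hu) ps phs sh
      where
      u = s ∙ t
      inverse-squares : s ∙ s ≈ s ⁻¹ ∙ s ⁻¹
      inverse-squares = deduce 2 (λ s t → s ⊕ s ⊜ ⊝ s ⊕ ⊝ s ⟸ :ε ◂ s ⊕ s ⊜ t ⊕ t & t ⊕ t ◂ s ⊕ s ⊜ ⊝ t ⊕ ⊝ t)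
        ≡.refl (s ∷ t ∷ []) q p
      su : s ∙ u ≈ u ⁻¹ ∙ s
      su = deduce 2 (λ s t → s ⊕ (s ⊕ t) ⊜ ⊝ (s ⊕ t) ⊕ s ⟸ :ε ◂ s ⊕ s ⊜ ⊝ t ⊕ ⊝ t) ≡.refl (s ∷ t ∷ []) p
      sts : ¬ s ∙ t ∙ s ≈ t
      sts r = st′ (deduce 2 (λ s t → s ⊕ t ⊜ ⊝ t ⊕ s ⟸
        :ε ◂ s ⊕ t ⊕ s ⊜ t & ⊝ t ◂ t ⊕ t ⊜ s ⊕ s) ≡.refl (s ∷ t ∷ []) r (sym q))
      us : ¬ u ∙ s ≈ s ∙ u
      us r = st (deduce 2 (λ s t → s ⊕ t ⊜ t ⊕ s ⟸ ⊝ s ◂ s ⊕ (s ⊕ t) ⊜ s ⊕ t ⊕ s) ≡.refl (s ∷ t ∷ []) (sym r))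
      us′ : ¬ u ∙ s ≈ s ⁻¹ ∙ u
      us′ r = sts (trans r (\\-leftDividesʳ s t))
      uu : ¬ u ∙ u ≈ s ⁻¹ ∙ s ⁻¹
      uu r = sts (deduce 2 (λ s t → s ⊕ t ⊕ s ⊜ t ⟸ :ε ◂ s ⊕ t ⊕ (s ⊕ t) ⊜ ⊝ s ⊕ ⊝ s & :ε ◂ ⊝ s ⊕ ⊝ s ⊜ s ⊕ s & :ε ◂ s ⊕ s ⊜ t ⊕ t)
        ≡.refl (s ∷ t ∷ []) r (sym inverse-squares) q)
      u² : ¬ u ∙ u ≈ ε
      u² r = st (deduce 2 (λ s t → s ⊕ t ⊜ t ⊕ s ⟸ :ε ◂ s ⊕ t ⊕ (s ⊕ t) ⊜ :ε & t ◂ ⊝ t ⊕ ⊝ t ⊜ s ⊕ s)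
        ≡.refl (s ∷ t ∷ []) r (sym p))
      witness = inverting-neither s² u² su
      h = proj₁ witness
      hu = proj₁ (proj₂ witness)
      sh = proj₂ (proj₂ witness)

    noncentral-colours : ∀ {s} → ¬ Central s → ∃ λ L → length L ≤ 5 × Determines (s ∷ L) s
    noncentral-colours {s} nc = case (s ∙ s) ≟ ε of λ where
      (yes ss) → [] , z≤n , involution-colours ss
      (no s²)  → let t , st , st′ = neither nc s² in case triangle-colours± st st′ of λ where
        (inj₁ (L , L≤2 , det)) → L , ≤-trans L≤2 (s≤s (s≤s z≤n)) , det
        (inj₂ (p , q))         → equal-squares-colours s² st st′ p q

    -- The remaining case s² = t² = t⁻² makes s⁴ trivial while s² is not, so s has order 4.
    noncentral-colours-no4 : NoElementOfOrder4 G →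
                             ∀ {s} → ¬ Central s → ∃ λ L → length L ≤ 2 × Determines (s ∷ L) s
    noncentral-colours-no4 no4 {s} nc = case (s ∙ s) ≟ ε of λ where
      (yes ss) → [] , z≤n , involution-colours ss
      (no s²)  → let t , st , st′ = neither nc s² in case triangle-colours± st st′ of λ where
        (inj₁ found)   → found
        (inj₂ (p , q)) → contradiction
          (order-4 (deduce 2 (λ s t → s ⊕ s ⊜ ⊝ s ⊕ ⊝ s ⟸ :ε ◂ s ⊕ s ⊜ t ⊕ t & t ⊕ t ◂ s ⊕ s ⊜ ⊝ t ⊕ ⊝ t)
            ≡.refl (s ∷ t ∷ []) q p) s²) (no4 s)

    -- Each of the three exceptions of the triangle rule makes s² commute with t.
    square-noncentral-colours : ∀ {s} → ¬ Central (s ∙ s) →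
                                ∃ λ L → length L ≤ 2 × Determines (s ∷ L) s
    square-noncentral-colours {s} nc with noncentral nc
    ... | t , sst = t ∷ s ∙ t ∷ [] , s≤s (s≤s z≤n) , triangle-colours
      (λ p → sst (deduce 2 (λ s t → s ⊕ s ⊕ t ⊜ t ⊕ (s ⊕ s) ⟸ s ◂ s ⊕ t ⊜ t ⊕ s & :ε ◂ s ⊕ t ⊜ t ⊕ s)
         ≡.refl (s ∷ t ∷ []) p p))
      (λ p → sst (deduce 2 (λ s t → s ⊕ s ⊕ t ⊜ t ⊕ (s ⊕ s) ⟸ s ◂ s ⊕ t ⊜ ⊝ t ⊕ s & t ◂ ⊝ t ⊕ s ⊜ s ⊕ t)
         ≡.refl (s ∷ t ∷ []) p (sym p)))
      (λ p → sst (deduce 2 (λ s t → s ⊕ s ⊕ t ⊜ t ⊕ (s ⊕ s) ⟸ :ε ◂ s ⊕ s ⊜ ⊝ t ⊕ ⊝ t & t ◂ ⊝ t ⊕ ⊝ t ⊜ s ⊕ s)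
         ≡.refl (s ∷ t ∷ []) p (sym p)))

    center-trivial : NoNontrivialCharacteristicAbelianSubgroup G → ∀ {z} → Central z → ¬ ¬ z ≈ ε
    center-trivial nochar {z} central z≉ε = nochar (Central
      , record
          { resp-≈    = λ x≈y cx t → trans (∙-congʳ (sym x≈y)) (trans (cx t) (∙-congˡ x≈y))
          ; ε-closed  = λ t → trans (identityˡ t) (sym (identityʳ t))
          ; ∙-closed  = λ {x} {y} cx cy t → deduce 3 (λ x y t → x ⊕ y ⊕ t ⊜ t ⊕ (x ⊕ y) ⟸
                          x ◂ y ⊕ t ⊜ t ⊕ y & :ε ◂ x ⊕ t ⊜ t ⊕ x) ≡.refl (x ∷ y ∷ t ∷ []) (cy t) (cx t)
          ; ⁻¹-closed = λ {x} cx t → deduce 2 (λ x t → ⊝ x ⊕ t ⊜ t ⊕ ⊝ x ⟸ ⊝ x ◂ t ⊕ x ⊜ x ⊕ t)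
                          ≡.refl (x ∷ t ∷ []) (sym (cx t))
          }
      , (λ {x} {y} cx _ → cx y)
      , (λ φ iso {a} ca t → central-image φ iso ca t)
      , z , central , z≉ε)
      where
      central-image : ∀ φ → IsGroupIsomorphism φ → ∀ {a} → Central a → Central (φ a)
      central-image φ iso {a} ca t with IsGroupIsomorphism.surjective iso t
      ... | t′ , φt′ = trans (∙-congˡ (sym (φt′ refl))) (trans (sym (∙-homo a t′))
              (trans (⟦⟧-cong (ca t′)) (trans (∙-homo t′ a) (∙-congʳ (φt′ refl)))))
        where open IsGroupIsomorphism iso

    -- The centre is characteristic and abelian, hence trivial here, so s² is noncentral as soon as
    -- it is nontrivial.
    noncentral-colours-nochar : NoNontrivialCharacteristicAbelianSubgroup G →
                                ∀ {s} → ¬ Central s → ∃ λ L → length L ≤ 2 × Determines (s ∷ L) s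
    noncentral-colours-nochar nochar {s} nc = case (s ∙ s) ≟ ε of λ where
      (yes ss) → [] , z≤n , involution-colours ss
      (no s²)  → square-noncentral-colours λ central → center-trivial nochar central s²

    noncentral-colours′ : NoElementOfOrder4 G ⊎ NoNontrivialCharacteristicAbelianSubgroup G →
                          ∀ {s} → ¬ Central s → ∃ λ L → length L ≤ 2 × Determines (s ∷ L) s
    noncentral-colours′ = [ noncentral-colours-no4 , noncentral-colours-nochar ]′

  private
    centralizes : ∀ {S y} → (∀ {s} → S s → y ∙ s ≈ s ∙ y) → ∀ {x} → Generated G S x → y ∙ x ≈ x ∙ y
    centralizes         com (gen s)        = com s
    centralizes         com unit           = trans (identityʳ _) (sym (identityˡ _))
    centralizes {y = y} com (mul {x} {x′} p q) =
      deduce 3 (λ y x x′ → y ⊕ (x ⊕ x′) ⊜ x ⊕ x′ ⊕ y ⟸ :ε ◂ y ⊕ x ⊜ x ⊕ y & x ◂ y ⊕ x′ ⊜ x′ ⊕ y)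
        ≡.refl (y ∷ x ∷ x′ ∷ []) (centralizes com p) (centralizes com q)
    centralizes {y = y} com (inv {x} p)    =
      deduce 2 (λ y x → y ⊕ ⊝ x ⊜ ⊝ x ⊕ y ⟸ ⊝ x ◂ x ⊕ y ⊜ y ⊕ x)
        ≡.refl (y ∷ x ∷ []) (sym (centralizes com p))
    centralizes         com (resp x≈x′ p)  =
      trans (∙-congˡ (sym x≈x′)) (trans (centralizes com p) (∙-congʳ x≈x′))

  generators-commute : ∀ {S} → (∀ x → Generated G S x) → (∀ {s t} → S s → S t → s ∙ t ≈ t ∙ s) → IsAbelian G
  generators-commute generates com x y =
    centralizes (λ t → sym (centralizes (λ s → com t s) (generates x))) (generates y)

  length-concat-map : ∀ {a b} {A : Set a} {B : Set b} {k} (h : A → List B) → (∀ x → length (h x) ≤ k) →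
                      ∀ xs → length (concat (map h xs)) ≤ k * length xs
  length-concat-map         h h≤k []       = z≤n
  length-concat-map {k = k} h h≤k (x ∷ xs) = begin
    length (concat (map h (x ∷ xs)))                ≡⟨ length-++ (h x) ⟩
    length (h x) + length (concat (map h xs))      ≤⟨ +-mono-≤ (h≤k x) (length-concat-map h h≤k xs) ⟩
    k + k * length xs                             ≡⟨ *-suc k (length xs) ⟨
    k * length (x ∷ xs)                            ∎
    where open ≤-Reasoning

  module _ (nonabelian : ¬ IsAbelian G) {k : ℕ} (1≤k : 1 ≤ k)
           (nc-colours : ∀ {s} → ¬ Central s → ∃ λ L → length L ≤ k × Determines (s ∷ L) s)
           {S : Subset G} (generates : ∀ x → Generated G S x) {xs : List Carrier}
           (S⊆xs : ∀ {s} → S s → s ∈ xs) where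

    private
      noncommuting : ∃ λ a → a ∈ xs × ∃ λ b → b ∈ xs × ¬ a ∙ b ≈ b ∙ a
      noncommuting = by-contradiction λ none → nonabelian (generators-commute generates λ {s} {t} Ss St →
        case (s ∙ t) ≟ (t ∙ s) of λ where
          (yes p) → p
          (no ¬p) → contradiction (s , S⊆xs Ss , t , S⊆xs St , ¬p) none)

      a = proj₁ noncommuting
      a∈xs = proj₁ (proj₂ noncommuting)
      b = proj₁ (proj₂ (proj₂ noncommuting))
      b∈xs = proj₁ (proj₂ (proj₂ (proj₂ noncommuting)))
      ab = proj₂ (proj₂ (proj₂ (proj₂ noncommuting)))

      -- The triangle rule cannot reach a central s. The product rule can, with the single extra
      -- label us, from any u with u² ≠ ε, since a central s inverts u only if u = u⁻¹. If a and b
      -- are involutions, ab serves, because they do not commute.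
      pivot : ∃ λ u → ¬ u ∙ u ≈ ε × (∀ f (f-cong : Congruent _≈_ _≈_ f) → let open Rigidity G f-cong in
                CommutesWith a → CommutesWith b → CommutesWith u)
      pivot = case (a ∙ a) ≟ ε of λ where
        (no a²)  → a , a² , λ _ _ p _ → p
        (yes aa) → case (b ∙ b) ≟ ε of λ where
          (no b²)  → b , b² , λ _ _ _ p → p
          (yes bb) → a ∙ b
            , (λ abab → ab (deduce 2 (λ a b → a ⊕ b ⊜ b ⊕ a ⟸
                :ε ◂ a ⊕ b ⊕ (a ⊕ b) ⊜ :ε & ⊝ b ◂ :ε ⊜ a ⊕ a & :ε ◂ :ε ⊜ b ⊕ b)
                ≡.refl (a ∷ b ∷ []) abab (sym aa) (sym bb)))
            , λ f f-cong pa pb → Rigidity.commutesWith-∙ G {f} (λ {x} {y} → f-cong {x} {y}) pa pb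

      u = proj₁ pivot

      colours : ∀ s → ∃ λ L → length L ≤ k × (¬ Central s → Determines (s ∷ L) s) ×
        (Central s → ∀ f (f-cong : Congruent _≈_ _≈_ f) → let open Rigidity G f-cong in
          CommutesWith u → All PreservesColour (s ∷ L) → CommutesWith s)
      colours s = case lem {Central s} of λ where
        (no nc)  → let L , L≤k , det = nc-colours nc in L , L≤k , (λ _ → det) , λ c → contradiction c nc
        (yes cs) → u ∙ s ∷ [] , 1≤k , contradiction cs , λ where
          _ f f-cong pu (ps ∷ pus ∷ []) → Rigidity.product-rule G f-cong pu ps pus
            λ p → proj₁ (proj₂ pivot) (deduce 2 (λ s u → u ⊕ u ⊜ :ε ⟸ u ◂ u ⊕ s ⊜ s ⊕ u & u ◂ s ⊕ u ⊜ ⊝ u ⊕ s)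
              ≡.refl (s ∷ u ∷ []) (sym (cs u)) p)

    two-generators : 2 ≤ length xs
    two-generators = distinct xs a∈xs b∈xs λ a≈b → ab (∙-cong a≈b (sym a≈b))
      where
      distinct : ∀ xs {x y} → x ∈ xs → y ∈ xs → ¬ x ≈ y → 2 ≤ length xs
      distinct (_ ∷ _)     (here p)  (here q)  ¬p = contradiction (trans p (sym q)) ¬p
      distinct (_ ∷ _ ∷ _) (here _)  (there _) _  = s≤s (s≤s z≤n)
      distinct (_ ∷ _ ∷ _) (there _) _         _  = s≤s (s≤s z≤n)

    -- Each generator is accompanied by at most k further labels. The noncentral generators, a and b
    -- among them, are settled by their own labels; a and b yield the pivot, and the pivot yields
    -- the central generators.
    generator-colours : ∃ λ X → length X ≤ suc k * length xs × (∀ {x} → x ∈ xs → x ∈ X) ×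
      (∀ f (f-cong : Congruent _≈_ _≈_ f) → let open Rigidity G f-cong in
        All PreservesColour X → ∀ {x} → x ∈ xs → CommutesWith x)
    generator-colours = concat (map block xs)
      , length-concat-map block (λ s → s≤s (proj₁ (proj₂ (colours s)))) xs
      , x∈xs⇒x∈X xs
      , λ f f-cong preserves → let
          open Rigidity G f-cong
          blocks = All.map⁻ (All.concat⁻ preserves)
          noncentrals : All (λ s → ¬ Central s → CommutesWith s) xs
          noncentrals = All.map (λ {s} ps nc → proj₁ (proj₂ (proj₂ (colours s))) nc f f-cong ps) blocks
          pa = lookup-noncentral f-cong noncentrals a∈xs λ central → ab (central b)
          pb = lookup-noncentral f-cong noncentrals b∈xs λ central → ab (sym (central a))
          pu = proj₂ (proj₂ pivot) f f-cong pa pb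
          all = All.map (λ {s} ps → case lem {Central s} of λ where
                  (yes cs) → proj₂ (proj₂ (proj₂ (colours s))) cs f f-cong pu ps
                  (no nc)  → proj₁ (proj₂ (proj₂ (colours s))) nc f f-cong ps) blocks
        in λ x∈xs → All.lookupₛ setoid commutesWith-resp all x∈xs
      where
      block : Carrier → List Carrier
      block s = s ∷ proj₁ (colours s)

      x∈xs⇒x∈X : ∀ xs {x} → x ∈ xs → x ∈ concat (map block xs)
      x∈xs⇒x∈X (_ ∷ xs) (here x≈y)   = here x≈y
      x∈xs⇒x∈X (y ∷ xs) (there x∈xs) = Any.++⁺ʳ (block y) (x∈xs⇒x∈X xs x∈xs)

      lookup-noncentral : ∀ {f} (f-cong : Congruent _≈_ _≈_ f) → let open Rigidity G f-cong in
        All (λ s → ¬ Central s → CommutesWith s) xs → ∀ {x} → x ∈ xs → ¬ Central x → CommutesWith x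
      lookup-noncentral {f} f-cong ps x∈xs = All.lookupₛ setoid
        (λ x≈y p nc → Rigidity.commutesWith-resp G {f} f-cong x≈y
          (p λ cx → nc λ t → trans (∙-congʳ (sym x≈y)) (trans (cx t) (∙-congˡ x≈y)))) ps x∈xs

-- A pigeonhole principle

module _ {a b r : Level} {A : Set a} {B : Set b} where

  private
    delete : ∀ {P : Pred B r} {ys} → Any P ys → ∃ λ zs → length ys ≡ suc (length zs) ×
             (∀ {Q : Pred B r} → (∀ {y} → P y → ¬ Q y) → Any Q ys → Any Q zs)
    delete {ys = _ ∷ ys} (here p) = ys , ≡.refl , λ where
      disjoint (here q)  → contradiction q (disjoint p)
      disjoint (there q) → q
    delete {ys = y ∷ ys} (there p) with delete p
    ... | zs , eq , keep = y ∷ zs , ≡.cong suc eq , λ where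
      disjoint (here q)  → here q
      disjoint (there q) → there (keep disjoint q)

  -- The injection from xs to ys is given as a relation, which lets the same principle compare
  -- triangle counts and find an exponent that avoids finitely many values.
  pigeonhole : ∀ {d} {D : A → A → Set d} {R : A → B → Set r} {xs ys} →
               (∀ {x x′ y} → D x x′ → R x y → ¬ R x′ y) →
               AllPairs D xs → All (λ x → Any (R x) ys) xs → length xs ≤ length ys
  pigeonhole disjoint []              _        = z≤n
  pigeonhole {D = D} {R} {x ∷ xs} {ys} disjoint (x# ∷ distinct) (p ∷ ps) with delete p
  ... | zs , eq , keep =
    ≤-trans (s≤s (pigeonhole disjoint distinct (kept x# ps))) (≤-reflexive (≡.sym eq))
    where
    kept : ∀ {xs} → All (D x) xs → All (λ x → Any (R x) ys) xs → All (λ x → Any (R x) zs) xs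
    kept []         []       = []
    kept (d ∷ x#)   (q ∷ ps) = keep (disjoint d) q ∷ kept x# ps

-- Triangle counts and their growth under extension

module Triangles {c ℓ} (em : ExcludedMiddle (lsuc (c ⊔ ℓ))) (G : Group c ℓ) where
  open Group G
  open Algebra.Properties.Group G
  open Data.List.Membership.Setoid setoid using (_∈_; _∉_)
  open FreeGroupSolver G
  open Dicyclic em G using (lem; _≟_)

  decSetoid : DecSetoid c ℓ
  decSetoid = record { isDecEquivalence = record { isEquivalence = isEquivalence ; _≟_ = _≟_ } }

  ∈-resp : ∀ {x y xs} → x ≈ y → x ∈ xs → y ∈ xs
  ∈-resp = Membership.∈-resp-≈ setoid

  SymmetricList : List Carrier → Set (c ⊔ ℓ)
  SymmetricList T = ∀ {x} → x ∈ T → x ⁻¹ ∈ T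

  -- The third vertex of the triangle on the edge from ε to e is u; by left multiplication the count
  -- is the same for every edge labelled e.
  Triangle : List Carrier → Carrier → Carrier → Set (c ⊔ ℓ)
  Triangle T e u = u ∈ T × u ⁻¹ ∙ e ∈ T

  abstract
    triangles : List Carrier → Carrier → List Carrier
    triangles T e = deduplicate _≟_ (filter (λ u → lem {u ⁻¹ ∙ e ∈ T}) T)

    triangles-unique : ∀ T e → AllPairs (λ u v → ¬ u ≈ v) (triangles T e)
    triangles-unique T e = Unique.deduplicate-! decSetoid (filter (λ u → lem) T)

    ∈-triangles⁺ : ∀ {T e u} → Triangle T e u → u ∈ triangles T e
    ∈-triangles⁺ {T} {e} (u∈T , v∈T) = Membership.∈-deduplicate⁺ setoid _≟_ (λ p q → trans q (sym p))
      (Membership.∈-filter⁺ setoid (λ u → lem {u ⁻¹ ∙ e ∈ T}) (λ p → ∈-resp (∙-congʳ (⁻¹-cong p))) u∈T v∈T)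

    ∈-triangles⁻ : ∀ {T e u} → u ∈ triangles T e → Triangle T e u
    ∈-triangles⁻ {T} {e} u∈ = Membership.∈-filter⁻ setoid (λ u → lem {u ⁻¹ ∙ e ∈ T}) (λ p → ∈-resp (∙-congʳ (⁻¹-cong p)))
      (Membership.∈-deduplicate⁻ setoid _≟_ _ u∈)

  N : List Carrier → Carrier → ℕ
  N T e = length (triangles T e)

  private
    all-triangles : ∀ {p} {P : Pred Carrier p} {T e} → (∀ {u} → Triangle T e u → P u) → All P (triangles T e)
    all-triangles {P = P} {T} {e} h = go λ u∈ → h (∈-triangles⁻ u∈)
      where
      go : ∀ {us} → (∀ {u} → u ∈ us → P u) → All P us
      go {[]}     h = []
      go {u ∷ us} h = h (here refl) ∷ go (h ∘ there)

  N-≤-length : ∀ {T e ys} → (∀ {u} → Triangle T e u → u ∈ ys) → N T e ≤ length ys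
  N-≤-length h = pigeonhole {R = _≈_} (λ u≉v p q → u≉v (trans p (sym q))) (triangles-unique _ _) (all-triangles h)

  N-≤ : ∀ {T e T′ e′} {R : Carrier → Carrier → Set ℓ} →
        (∀ {u v v′} → v ≈ v′ → R u v → R u v′) → (∀ {u u′ v} → R u v → R u′ v → u ≈ u′) →
        (∀ {u} → Triangle T e u → ∃ λ v → Triangle T′ e′ v × R u v) → N T e ≤ N T′ e′
  N-≤ {R = R} R-resp unique h = pigeonhole {R = R}
    (λ u≉v p q → u≉v (unique p q)) (triangles-unique _ _)
    (all-triangles λ t → let _ , t′ , p = h t in Any.map (λ v≈v′ → R-resp v≈v′ p) (∈-triangles⁺ t′))

  N-mono : ∀ {T e T′ e′} → (∀ {u} → Triangle T e u → Triangle T′ e′ u) → N T e ≤ N T′ e′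
  N-mono h = N-≤-length (∈-triangles⁺ ∘ h)

  N-mono-< : ∀ {T e T′ e′ w} → (∀ {u} → Triangle T e u → Triangle T′ e′ u) →
             ¬ Triangle T e w → Triangle T′ e′ w → N T e < N T′ e′
  N-mono-< {T} {e} {w = w} h w∉ w∈ =
    pigeonhole {R = _≈_} {xs = w ∷ triangles T e}
      (λ u≉v p q → u≉v (trans p (sym q)))
      ((all-triangles λ {u} t w≈u → w∉ (∈-resp (sym w≈u) (proj₁ t) ,
           ∈-resp (∙-congʳ (⁻¹-cong (sym w≈u))) (proj₂ t))) ∷ triangles-unique T e)
      (∈-triangles⁺ w∈ ∷ all-triangles (∈-triangles⁺ ∘ h))

  N-resp : ∀ {T e e′} → e ≈ e′ → N T e ≡ N T e′
  N-resp e≈e′ = ≤-antisym (N-mono λ (p , q) → p , ∈-resp (∙-congˡ e≈e′) q)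
                          (N-mono λ (p , q) → p , ∈-resp (∙-congˡ (sym e≈e′)) q)

  private
    -- Left multiplication by e⁻¹ carries the edge from ε to e to the one from e⁻¹ to ε, and the
    -- third vertex u to e⁻¹u.
    N-⁻¹-≤ : ∀ {T} → SymmetricList T → ∀ e → N T e ≤ N T (e ⁻¹)
    N-⁻¹-≤ T-sym e = N-≤ {R = λ u v → v ≈ e ⁻¹ ∙ u} (λ p q → trans (sym p) q)
      (λ p q → ∙-cancelˡ _ _ _ (trans (sym p) q))
      λ {u} (p , q) → e ⁻¹ ∙ u
        , ( ∈-resp (deduce 2 (λ u e → ⊝ (⊝ u ⊕ e) ⊜ ⊝ e ⊕ u ⟸ []) ≡.refl (u ∷ e ∷ [])) (T-sym q)
          , ∈-resp (deduce 2 (λ u e → ⊝ u ⊜ ⊝ (⊝ e ⊕ u) ⊕ ⊝ e ⟸ []) ≡.refl (u ∷ e ∷ [])) (T-sym p) )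
        , refl

  N-⁻¹ : ∀ {T} → SymmetricList T → ∀ e → N T (e ⁻¹) ≡ N T e
  N-⁻¹ T-sym e = ≤-antisym (≤-trans (N-⁻¹-≤ T-sym (e ⁻¹)) (≤-reflexive (N-resp (⁻¹-involutive e)))) (N-⁻¹-≤ T-sym e)

  -- Triviality is excluded label by label, since labels that are products, such as us, may happen
  -- to be ε.
  record ColourSeparation (X : List Carrier) : Set (c ⊔ ℓ) where
    field
      {T}        : List Carrier
      T-sym      : SymmetricList T
      ε∉T        : ε ∉ T
      coloured   : ∀ {s} → s ∈ X → ¬ s ≈ ε → s ∈ T
      determined : ∀ {s t} → s ∈ X → ¬ s ≈ ε → t ∈ T → N T t ≡ N T s → t ≈ s ⊎ t ≈ s ⁻¹
      bounded    : length T ≤ 2 * length X * length X + 28 * length X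

  -- Adding x, s⁻¹x and their inverses to T creates the triangle 1, x, s on the edge
  -- from 1 to s.  The hypotheses limit the other edges in T that gain a triangle to
  -- exceptional ones.
  module Extension
    {T} (T-sym : SymmetricList T) (ε∉T : ε ∉ T) {s} (s∈T : s ∈ T) {x}
    (fresh : ∀ p q → p ∈ ε ∷ T → q ∈ ε ∷ T → ¬ x ≈ p ∙ q × ¬ x ≈ s ∙ (p ∙ q))
    {Exceptional : Pred Carrier ℓ} (exc-resp : ∀ {a b} → a ≈ b → Exceptional a → Exceptional b)
    (exc-⁻¹ : ∀ {a} → Exceptional a → Exceptional (a ⁻¹)) (exc-s : Exceptional s)
    (xx : x ∙ x ∉ T) (yx : s ⁻¹ ∙ x ∙ x ∉ T)
    (x⁻¹y : x ⁻¹ ∙ (s ⁻¹ ∙ x) ∈ T → Exceptional (x ⁻¹ ∙ (s ⁻¹ ∙ x)))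
    (xy : x ∙ (s ⁻¹ ∙ x) ∈ T → Exceptional (x ∙ (s ⁻¹ ∙ x)))
    (yy : s ⁻¹ ∙ x ∙ (s ⁻¹ ∙ x) ∈ T → Exceptional (s ⁻¹ ∙ x ∙ (s ⁻¹ ∙ x))) where

    y : Carrier
    y = s ⁻¹ ∙ x

    new T′ : List Carrier
    new = x ∷ x ⁻¹ ∷ y ∷ y ⁻¹ ∷ []
    T′  = new ++ T

    private
      W : List Carrier
      W = ε ∷ T

      W-sym : SymmetricList W
      W-sym (here p)  = here (trans (⁻¹-cong p) ε⁻¹≈ε)
      W-sym (there p) = there (T-sym p)

      x-fresh : ∀ {p q} → p ∈ W → q ∈ W → ¬ x ≈ p ∙ q
      x-fresh p q = proj₁ (fresh _ _ p q)

      y-fresh : ∀ {p q} → p ∈ W → q ∈ W → ¬ y ≈ p ∙ q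
      y-fresh p q y≈ = proj₂ (fresh _ _ p q) (trans (sym (\\-leftDividesˡ s x)) (∙-congˡ y≈))

      invert : ∀ {t a p q} → t ≈ a ⁻¹ → t ≈ p ∙ q → a ≈ q ⁻¹ ∙ p ⁻¹
      invert t≈ t≈pq = trans (sym (⁻¹-involutive _)) (trans (⁻¹-cong (trans (sym t≈) t≈pq)) (⁻¹-anti-homo-∙ _ _))

    -- As ε is allowed as a factor, this covers both that new elements avoid T and ε and that no
    -- triangle has exactly one new edge.
    new-fresh : ∀ {t p q} → t ∈ new → p ∈ ε ∷ T → q ∈ ε ∷ T → ¬ t ≈ p ∙ q
    new-fresh (here t≈)                         p q t≈pq = x-fresh p q (trans (sym t≈) t≈pq)
    new-fresh (there (here t≈))                 p q t≈pq = x-fresh (W-sym q) (W-sym p) (invert t≈ t≈pq)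
    new-fresh (there (there (here t≈)))         p q t≈pq = y-fresh p q (trans (sym t≈) t≈pq)
    new-fresh (there (there (there (here t≈)))) p q t≈pq = y-fresh (W-sym q) (W-sym p) (invert t≈ t≈pq)

    new-∉ : ∀ {t} → t ∈ new → t ∉ T
    new-∉ n t∈T = new-fresh n (there t∈T) (here refl) (sym (identityʳ _))

    private
      new-sym : SymmetricList new
      new-sym (here t≈)                         = there (here (⁻¹-cong t≈))
      new-sym (there (here t≈))                 = here (trans (⁻¹-cong t≈) (⁻¹-involutive _))
      new-sym (there (there (here t≈)))         = there (there (there (here (⁻¹-cong t≈))))
      new-sym (there (there (there (here t≈)))) = there (there (here (trans (⁻¹-cong t≈) (⁻¹-involutive _))))

    T′-sym : SymmetricList T′
    T′-sym p with Any.++⁻ new p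
    ... | inj₁ n = Any.++⁺ˡ (new-sym n)
    ... | inj₂ o = Any.++⁺ʳ new (T-sym o)

    ε∉T′ : ε ∉ T′
    ε∉T′ p with Any.++⁻ new p
    ... | inj₁ n = new-fresh n (here refl) (here refl) (sym (identityʳ ε))
    ... | inj₂ o = ε∉T o

    private
      module _ {u v : Carrier} where
        direct : ∀ {w} → (w ∈ T → Exceptional w) → u ∙ v ≈ w → u ∙ v ∈ T → Exceptional (u ∙ v)
        direct h eq p = exc-resp (sym eq) (h (∈-resp eq p))

        inverted : ∀ {w} → (w ∈ T → Exceptional w) → u ∙ v ≈ w ⁻¹ → u ∙ v ∈ T → Exceptional (u ∙ v)
        inverted h eq p = exc-resp (sym eq) (exc-⁻¹ (h
          (∈-resp (trans (⁻¹-cong eq) (⁻¹-involutive _)) (T-sym p))))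

      never : ∀ {w} → w ∉ T → w ∈ T → Exceptional w
      never w∉T w∈T = contradiction w∈T w∉T

      ⁻¹-∙-⁻¹ : ∀ a b → a ⁻¹ ∙ b ⁻¹ ≈ (b ∙ a) ⁻¹
      ⁻¹-∙-⁻¹ a b = sym (⁻¹-anti-homo-∙ b a)

      -- Up to inversion, the sixteen products are ε, s = xy⁻¹ and the five that the hypotheses of
      -- the module deal with.
      new-product : ∀ {u v} → u ∈ new → v ∈ new → u ∙ v ∈ T → Exceptional (u ∙ v)
      new-product (here p) (here q) = direct (never xx) (∙-cong p q)
      new-product (here p) (there (here q)) = direct (never ε∉T) (trans (∙-cong p q) (inverseʳ x))
      new-product (here p) (there (there (here q))) = direct xy (∙-cong p q)
      new-product (here p) (there (there (there (here q)))) = direct (λ _ → exc-s) (trans (∙-cong p q)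
        (deduce 2 (λ x s → x ⊕ ⊝ (⊝ s ⊕ x) ⊜ s ⟸ []) ≡.refl (x ∷ s ∷ [])))
      new-product (there (here p)) (here q) = direct (never ε∉T) (trans (∙-cong p q) (inverseˡ x))
      new-product (there (here p)) (there (here q)) = inverted (never xx) (trans (∙-cong p q) (⁻¹-∙-⁻¹ x x))
      new-product (there (here p)) (there (there (here q))) = direct x⁻¹y (∙-cong p q)
      new-product (there (here p)) (there (there (there (here q)))) = inverted (never yx) (trans (∙-cong p q) (⁻¹-∙-⁻¹ x y))
      new-product (there (there (here p))) (here q) = direct (never yx) (∙-cong p q)
      new-product (there (there (here p))) (there (here q)) = inverted (λ _ → exc-s) (trans (∙-cong p q) (//-rightDividesʳ x _))
      new-product (there (there (here p))) (there (there (here q))) = direct yy (∙-cong p q)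
      new-product (there (there (here p))) (there (there (there (here q)))) = direct (never ε∉T) (trans (∙-cong p q) (inverseʳ y))
      new-product (there (there (there (here p)))) (here q) = inverted x⁻¹y (trans (∙-cong p q)
        (deduce 2 (λ x y → ⊝ y ⊕ x ⊜ ⊝ (⊝ x ⊕ y) ⟸ []) ≡.refl (x ∷ y ∷ [])))
      new-product (there (there (there (here p)))) (there (here q)) = inverted xy (trans (∙-cong p q) (⁻¹-∙-⁻¹ y x))
      new-product (there (there (there (here p)))) (there (there (here q))) = direct (never ε∉T) (trans (∙-cong p q) (inverseˡ y))
      new-product (there (there (there (here p)))) (there (there (there (here q)))) = inverted yy (trans (∙-cong p q) (⁻¹-∙-⁻¹ y y))

    -- A triangle gained by an old edge has two new edges, because it cannot have just one; so e is
    -- a product of two new elements.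
    N-old : ∀ {e} → e ∈ T → ¬ Exceptional e → N T′ e ≡ N T e
    N-old {e} e∈T ¬exc = ≤-antisym (N-mono shrink) (N-mono λ (p , q) → Any.++⁺ʳ new p , Any.++⁺ʳ new q)
      where
      shrink : ∀ {u} → Triangle T′ e u → Triangle T e u
      shrink {u} (p , q) with Any.++⁻ new p | Any.++⁻ new q
      ... | inj₂ u∈T | inj₂ v∈T = u∈T , v∈T
      ... | inj₁ u∈n | inj₁ v∈n = contradiction
        (exc-resp (\\-leftDividesˡ u e) (new-product u∈n v∈n (∈-resp (sym (\\-leftDividesˡ u e)) e∈T))) ¬exc
      ... | inj₁ u∈n | inj₂ v∈T = contradiction (deduce 2 (λ u e → u ⊜ e ⊕ ⊝ (⊝ u ⊕ e) ⟸ []) ≡.refl (u ∷ e ∷ []))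
        (new-fresh u∈n (there e∈T) (there (T-sym v∈T)))
      ... | inj₂ u∈T | inj₁ v∈n = contradiction refl (new-fresh v∈n (there (T-sym u∈T)) (there e∈T))

    N-grow : N T s < N T′ s
    N-grow = N-mono-< (λ (p , q) → Any.++⁺ʳ new p , Any.++⁺ʳ new q)
      (λ (p , _) → new-∉ (here refl) p)
      (here refl , there (there (there (here
        (deduce 2 (λ x s → ⊝ x ⊕ s ⊜ ⊝ (⊝ s ⊕ x) ⟸ []) ≡.refl (x ∷ s ∷ []))))))

    -- One of the two other edges of a triangle on t is new and different from t.
    N-new : ∀ {t} → t ∈ new → N T′ t ≤ 6
    N-new {t} t∈n = ≤-trans (N-≤-length candidates) six
      where
      others : List Carrier
      others = filter (λ u → ¬? (u ≟ t)) new

      ∈-others : ∀ {u} → u ∈ new → ¬ u ≈ t → u ∈ others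
      ∈-others = Membership.∈-filter⁺ setoid (λ u → ¬? (u ≟ t)) (λ p u≉t q → u≉t (trans p q))

      three : length others ≤ 3
      three = case filter-notAll (λ u → ¬? (u ≟ t)) new (Any.map (λ t≈u u≉t → u≉t (sym t≈u)) t∈n) of λ where
        (s≤s p) → p

      six : length (others ++ map (λ v → t ∙ v ⁻¹) others) ≤ 6
      six = begin
        length (others ++ map (λ v → t ∙ v ⁻¹) others)             ≡⟨ length-++ others ⟩
        length others + length (map (λ v → t ∙ v ⁻¹) others)      ≡⟨ ≡.cong (length others +_) (length-map _ others) ⟩
        length others + length others                              ≤⟨ +-mono-≤ three three ⟩
        6 ∎
        where open ≤-Reasoning

      candidates : ∀ {u} → Triangle T′ t u → u ∈ others ++ map (λ v → t ∙ v ⁻¹) others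
      candidates {u} (p , q) with Any.++⁻ new p | Any.++⁻ new q
      ... | inj₁ u∈n | _ = Any.++⁺ˡ (∈-others u∈n λ u≈t →
        ε∉T′ (∈-resp (trans (∙-congʳ (⁻¹-cong u≈t)) (inverseˡ t)) q))
      ... | inj₂ _ | inj₁ v∈n = Any.++⁺ʳ others (∈-resp
        (deduce 2 (λ u t → t ⊕ ⊝ (⊝ u ⊕ t) ⊜ u ⟸ []) ≡.refl (u ∷ t ∷ []))
        (Membership.∈-map⁺ setoid setoid (λ p → ∙-congˡ (⁻¹-cong p)) (∈-others v∈n λ v≈t →
          ε∉T′ (∈-resp (deduce 2 (λ u t → u ⊜ :ε ⟸ :ε ◂ t ⊜ ⊝ u ⊕ t) ≡.refl (u ∷ t ∷ []) (sym v≈t)) p))))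
      ... | inj₂ u∈T | inj₂ v∈T = contradiction (sym (\\-leftDividesˡ u t)) (new-fresh t∈n (there u∈T) (there v∈T))

-- Choice of a suitable power

module Powers {c ℓ} (em : ExcludedMiddle (lsuc (c ⊔ ℓ))) (G : Group c ℓ) where
  open Group G
  open Algebra.Properties.Group G
  open Algebra.Properties.Monoid.Mult monoid
    renaming (_×_ to power; ×-homo-+ to power-+; ×-assocˡ to power-power; ×-congʳ to power-cong; ×-congˡ to power-congˡ)
  open Data.List.Membership.Setoid setoid using (_∈_; _∉_)
  open FreeGroupSolver G
  open Dicyclic em G using (lem)
  open Triangles em G
  open Colours em G using (length-concat-map)

  TorsionFreeUpTo : ℕ → Carrier → Set ℓ
  TorsionFreeUpTo M a = ∀ j → 0 < j → j ≤ M → ¬ power j a ≈ ε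

  -- `OrderAtLeast` speaks only of exact orders. The induction supplies minimality: the least
  -- positive j with a to the power j trivial is the order of a.
  torsionFreeUpTo : ∀ {M n a} → M < n → OrderAtLeast G a n → TorsionFreeUpTo M a
  torsionFreeUpTo {M} {n} {a} M<n order = <-rec _ λ j below 0<j j≤M aʲ≈ε →
    n≮n M (<-≤-trans M<n (≤-trans (order j (0<j , aʲ≈ε , λ m 0<m aᵐ≈ε →
      ≮⇒≥ λ m<j → below m<j 0<m (≤-trans (<⇒≤ m<j) j≤M) aᵐ≈ε)) j≤M))

  power-∸ˡ : ∀ {i j} a → i ≤ j → power j a ≈ power (j ∸ i) a ∙ power i a
  power-∸ˡ {i} {j} a i≤j = trans (power-congˡ (≡.sym (m∸n+n≡m i≤j))) (power-+ a (j ∸ i) i)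

  power-∸ʳ : ∀ {i j} a → i ≤ j → power j a ≈ power i a ∙ power (j ∸ i) a
  power-∸ʳ {i} {j} a i≤j = trans (power-congˡ (≡.sym (m+[n∸m]≡n i≤j))) (power-+ a i (j ∸ i))

  power-injective : ∀ {M a i j} → TorsionFreeUpTo M a → i < j → j ≤ M → ¬ power i a ≈ power j a
  power-injective {a = a} {i} {j} tf i<j j≤M eq = tf (j ∸ i) (m<n⇒0<n∸m i<j) (≤-trans (m∸n≤m j i) j≤M)
    (∙-cancelʳ (power i a) _ _ (trans (sym (power-∸ˡ a (<⇒≤ i<j))) (trans (sym eq) (sym (identityˡ _)))))

  power-commute : ∀ {s b} → s ∙ b ≈ b ∙ s → ∀ i → s ∙ power i b ≈ power i b ∙ s
  power-commute         sb zero    = trans (identityʳ _) (sym (identityˡ _))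
  power-commute {s} {b} sb (suc i) =
    deduce 3 (λ s b p → s ⊕ (b ⊕ p) ⊜ b ⊕ p ⊕ s ⟸ :ε ◂ s ⊕ b ⊜ b ⊕ s & b ◂ s ⊕ p ⊜ p ⊕ s)
      ≡.refl (s ∷ b ∷ power i b ∷ []) sb (power-commute sb i)

  power-invert : ∀ {s b} → s ∙ b ≈ b ⁻¹ ∙ s → ∀ i → s ∙ power i b ≈ power i b ⁻¹ ∙ s
  power-invert         sb zero    = trans (identityʳ _) (sym (trans (∙-congʳ ε⁻¹≈ε) (identityˡ _)))
  power-invert {s} {b} sb (suc i) =
    deduce 3 (λ s b p → s ⊕ (b ⊕ p) ⊜ ⊝ (b ⊕ p) ⊕ s ⟸
      :ε ◂ s ⊕ b ⊜ ⊝ b ⊕ s & ⊝ b ◂ s ⊕ p ⊜ ⊝ p ⊕ s & ⊝ b ⊕ ⊝ p ◂ b ⊕ p ⊜ p ⊕ b)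
      ≡.refl (s ∷ b ∷ power i b ∷ []) sb (power-invert sb i) (power-commute refl i)

  AtMostOnce : ℕ → (ℕ → Set ℓ) → Set ℓ
  AtMostOnce K P = ∀ i j → i < j → j ≤ K → P i → ¬ P j

  -- Each property excludes at most one of the K exponents 1, ..., K, and there are fewer than K
  -- properties.
  avoid : ∀ {K} Ps → All (AtMostOnce K) Ps → length Ps < K →
          ∃ λ i → 0 < i × i ≤ K × All (λ P → ¬ P i) Ps
  avoid {K} Ps once few with map′ lower lift (em {Lift (lsuc (c ⊔ ℓ)) (∃ λ i → 0 < i × i ≤ K × All (λ P → ¬ P i) Ps)})
  ... | yes found = found
  ... | no  none  = contradiction (<-≤-trans few (≤-trans (≤-reflexive (≡.sym (length-applyUpTo suc K)))
      (pigeonhole {D = λ i j → i < j × j ≤ K} {R = Hits}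
        (λ (i<j , j≤K) (p , once) (q , _) → once _ _ i<j j≤K p q)
        (AllPairs.applyUpTo⁺₁ suc K (λ i<j j<K → s≤s i<j , j<K))
        (All.applyUpTo⁺₁ suc K λ {i} i<K → hit (s≤s z≤n) i<K)))) (n≮n _)
    where
    Hits : ℕ → (ℕ → Set ℓ) → Set ℓ
    Hits i P = P i × AtMostOnce K P

    hit : ∀ {i} → 0 < i → i ≤ K → Any (Hits i) Ps
    hit {i} 0<i i≤K with map′ lower lift (em {Lift (lsuc (c ⊔ ℓ)) (Any (Hits i) Ps)})
    ... | yes p = p
    ... | no ¬p = contradiction
      (i , 0<i , i≤K , All.zipWith (λ (miss , once) p → miss (p , once)) (All.¬Any⇒All¬ Ps ¬p , once)) none

  hits : (ℕ → Carrier) → List Carrier → List (ℕ → Set ℓ)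
  hits φ = map (λ h i → φ i ≈ h)

  hits-once : ∀ {K} φ L → (∀ i j → i < j → j ≤ K → ¬ φ i ≈ φ j) → All (AtMostOnce K) (hits φ L)
  hits-once φ L injective = All.map⁺ (All.universal (λ h i j i<j j≤K p q → injective i j i<j j≤K (trans p (sym q))) L)

  missed : ∀ φ L {i} → All (λ P → ¬ P i) (hits φ L) → φ i ∉ L
  missed φ L misses = All.All¬⇒¬Any (All.map⁻ misses)

  length-++≤ : ∀ {a} {A : Set a} (xs : List A) {ys m k} → length xs ≤ m → length ys ≤ k → length (xs ++ ys) ≤ m + k
  length-++≤ xs p q = ≤-trans (≤-reflexive (length-++ xs)) (+-mono-≤ p q)

  hits≤ : ∀ φ L {m} → length L ≤ m → length (hits φ L) ≤ m
  hits≤ φ L p = ≤-trans (≤-reflexive (length-map _ L)) p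

  -- Cancelling x on both sides leaves s⁻¹ = d⁻¹s⁻¹d.
  conj-injective : ∀ s x {x′ d} → x′ ≈ d ∙ x → x ⁻¹ ∙ (s ⁻¹ ∙ x) ≈ x′ ⁻¹ ∙ (s ⁻¹ ∙ x′) → s ∙ d ≈ d ∙ s
  conj-injective s x {d = d} x′≈ eq =
    deduce 3 (λ s x d → s ⊕ d ⊜ d ⊕ s ⟸ s ⊕ d ⊕ x ◂ ⊝ x ⊕ (⊝ s ⊕ x) ⊜ ⊝ (d ⊕ x) ⊕ (⊝ s ⊕ (d ⊕ x)))
      ≡.refl (s ∷ x ∷ d ∷ []) (trans eq (∙-cong (⁻¹-cong x′≈) (∙-congˡ x′≈)))

  -- Writing x′ as xd on the left and as dx on the right and cancelling x leaves s⁻¹ = ds⁻¹d.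
  twist-injective : ∀ s x {x′ d} → x′ ≈ d ∙ x → x′ ≈ x ∙ d →
                    x ∙ (s ⁻¹ ∙ x) ≈ x′ ∙ (s ⁻¹ ∙ x′) → s ∙ d ≈ d ⁻¹ ∙ s
  twist-injective s x {d = d} x′≈dx x′≈xd eq =
    deduce 3 (λ s x d → s ⊕ d ⊜ ⊝ d ⊕ s ⟸ s ⊕ ⊝ x ◂ x ⊕ d ⊕ (⊝ s ⊕ (d ⊕ x)) ⊜ x ⊕ (⊝ s ⊕ x))
      ≡.refl (s ∷ x ∷ d ∷ []) (sym (trans eq (∙-cong x′≈xd (∙-congˡ x′≈dx))))

  -- The element x is the i-th power of the j-th power of a with i, j ≤ K, and x² must be controlled
  -- too; hence exponents up to 2K times K.
  module Choice (K : ℕ) {a} (a-free : TorsionFreeUpTo ((K + K) * K) a) where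

    Inverting Centralizing : Carrier → Set ℓ
    Inverting    s = ∃ λ j → 0 < j × j ≤ K × s ∙ power j a ≈ power j a ⁻¹ ∙ s
    Centralizing s = ∃ λ j → 0 < j × j ≤ K × s ∙ power j a ≈ power j a ∙ s

    -- If s inverts x, then (s⁻¹x)² = s⁻², so that s² may gain a triangle as well.
    Exceptional : Carrier → Carrier → Set ℓ
    Exceptional s e = e ≈ s ⊎ e ≈ s ⁻¹ ⊎ (Inverting s × (e ≈ s ∙ s ⊎ e ≈ s ⁻¹ ∙ s ⁻¹))

    power-free : ∀ {j} → 0 < j → j ≤ K → TorsionFreeUpTo (K + K) (power j a)
    power-free {suc j} 0<j j≤K i@(suc _) 0<i i≤2K aⁱʲ = a-free (i * suc j) (s≤s z≤n) (*-mono-≤ i≤2K j≤K)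
      (trans (sym (power-power a i (suc j))) aⁱʲ)

    module _ {T} (T-sym : SymmetricList T) {s} (s∈T : s ∈ T) {n} (T≤n : length T ≤ n)
             -- The summands count the products of two elements of `ε ∷ T` and their translates by
             -- s, which x must avoid; the 3n values that x² must avoid; and, in the last of the
             -- three cases, n values for x⁻¹s⁻¹x and 2n for x s⁻¹x.
             (few : suc n * suc n + suc n * suc n + (n + n + n + (n + n + n)) < K) where

      private
        W products L₁ L₂ : List Carrier
        W = ε ∷ T
        products = concat (map (λ p → map (p ∙_) W) W)
        L₁ = products ++ map (s ∙_) products
        -- These are the values forbidden for x²: T and sT keep x² and s⁻¹x² out of T, and s²T keeps
        -- out (s⁻¹x)² when s centralizes x.
        L₂ = T ++ map (s ∙_) T ++ map ((s ∙ s) ∙_) T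

        ∈-products : ∀ {p q} → p ∈ W → q ∈ W → p ∙ q ∈ products
        ∈-products p∈W q∈W = Any.concat⁺ (Any.map⁺ (Any.map
          (λ p≈p′ → ∈-resp (∙-congʳ (sym p≈p′)) (Membership.∈-map⁺ setoid setoid ∙-congˡ q∈W)) p∈W))

        translates : ∀ t → length (map (t ∙_) T) ≤ n
        translates t = ≤-trans (≤-reflexive (length-map (t ∙_) T)) T≤n

        three : ∀ n → n + (n + n) ≡ n + n + n
        three = solve-∀

        2K≤ : K + K ≤ (K + K) * K
        2K≤ = ≤-trans (≤-reflexive (≡.sym (*-identityʳ (K + K)))) (*-monoʳ-≤ (K + K) (≤-trans (s≤s z≤n) few))

        Chosen : Carrier → Set (c ⊔ ℓ)
        Chosen x = x ∉ L₁ × x ∙ x ∉ L₂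

        choose : ∀ {b} → TorsionFreeUpTo (K + K) b →
                 ∀ extra → All (AtMostOnce K) extra → length extra ≤ n + n + n →
                 ∃ λ i → 0 < i × i ≤ K × Chosen (power i b) × All (λ P → ¬ P i) extra
        choose {b} b-free extra once extra≤ =
          let
            i , 0<i , i≤K , misses = avoid (hits φ L₁ ++ hits ψ L₂ ++ extra)
              (All.++⁺ (hits-once φ L₁ φ-injective) (All.++⁺ (hits-once ψ L₂ ψ-injective) once))
              (≤-<-trans count few)
            misses₁ , misses′ = All.++⁻ (hits φ L₁) misses
            misses₂ , misses₃ = All.++⁻ (hits ψ L₂) misses′
          in i , 0<i , i≤K , (missed φ L₁ misses₁ , missed ψ L₂ misses₂) , misses₃
          where
          φ ψ : ℕ → Carrier
          φ i = power i b
          ψ i = power i b ∙ power i b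

          K≤2K : ∀ {j} → j ≤ K → j ≤ K + K
          K≤2K j≤K = ≤-trans j≤K (+-mono-≤ {0} {K} z≤n ≤-refl)

          φ-injective : ∀ i j → i < j → j ≤ K → ¬ φ i ≈ φ j
          φ-injective i j i<j j≤K = power-injective b-free i<j (K≤2K j≤K)

          ψ-injective : ∀ i j → i < j → j ≤ K → ¬ ψ i ≈ ψ j
          ψ-injective i j i<j j≤K eq = power-injective b-free (+-mono-< i<j i<j) (+-mono-≤ j≤K j≤K)
            (trans (power-+ b i i) (trans eq (sym (power-+ b j j))))

          products≤ : length products ≤ suc n * suc n
          products≤ = ≤-trans (length-concat-map (λ p → map (p ∙_) W) (λ p → ≤-reflexive (length-map (p ∙_) W)) W)
                        (*-mono-≤ (s≤s T≤n) (s≤s T≤n))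

          count : length (hits φ L₁ ++ hits ψ L₂ ++ extra) ≤ suc n * suc n + suc n * suc n + (n + n + n + (n + n + n))
          count = length-++≤ (hits φ L₁)
            (hits≤ φ L₁ (length-++≤ products products≤ (≤-trans (≤-reflexive (length-map (s ∙_) products)) products≤)))
            (length-++≤ (hits ψ L₂)
              (hits≤ ψ L₂ (≤-trans (length-++≤ T T≤n (length-++≤ (map (s ∙_) T) (translates s) (translates (s ∙ s))))
                (≤-reflexive (three n)))) extra≤)

      module _ {x} (chosen : Chosen x) where
        private
          y = s ⁻¹ ∙ x

        fresh : ∀ p q → p ∈ W → q ∈ W → ¬ x ≈ p ∙ q × ¬ x ≈ s ∙ (p ∙ q)
        fresh _ _ p q = (λ eq → proj₁ chosen (Any.++⁺ˡ (∈-resp (sym eq) (∈-products p q))))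
          , (λ eq → proj₁ chosen (Any.++⁺ʳ products (∈-resp (sym eq)
               (Membership.∈-map⁺ setoid setoid ∙-congˡ (∈-products p q)))))

        xx∉T : x ∙ x ∉ T
        xx∉T p = proj₂ chosen (Any.++⁺ˡ p)

        xx∉sT : ∀ {e} → e ∈ T → ¬ x ∙ x ≈ s ∙ e
        xx∉sT p eq = proj₂ chosen (Any.++⁺ʳ T (Any.++⁺ˡ (∈-resp (sym eq) (Membership.∈-map⁺ setoid setoid ∙-congˡ p))))

        xx∉ssT : ∀ {e} → e ∈ T → ¬ x ∙ x ≈ s ∙ s ∙ e
        xx∉ssT p eq = proj₂ chosen (Any.++⁺ʳ T (Any.++⁺ʳ (map (s ∙_) T)
          (∈-resp (sym eq) (Membership.∈-map⁺ setoid setoid ∙-congˡ p))))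

        yx∉T : y ∙ x ∉ T
        yx∉T p = xx∉sT p (deduce 2 (λ s x → x ⊕ x ⊜ s ⊕ (⊝ s ⊕ x ⊕ x) ⟸ []) ≡.refl (s ∷ x ∷ []))

      Good : Carrier → Set (c ⊔ ℓ)
      Good x = let y = s ⁻¹ ∙ x in
        (∀ p q → p ∈ ε ∷ T → q ∈ ε ∷ T → ¬ x ≈ p ∙ q × ¬ x ≈ s ∙ (p ∙ q)) ×
        x ∙ x ∉ T × y ∙ x ∉ T ×
        (x ⁻¹ ∙ y ∈ T → Exceptional s (x ⁻¹ ∙ y)) ×
        (x ∙ y ∈ T → Exceptional s (x ∙ y)) ×
        (y ∙ y ∈ T → Exceptional s (y ∙ y))

      private
        -- Here s⁻¹x = x⁻¹s⁻¹, so that x⁻¹s⁻¹x, x s⁻¹x and (s⁻¹x)² equal s⁻¹x², s⁻¹ and s⁻².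
        good-inverting : ∀ {x} → Chosen x → Inverting s → s ∙ x ≈ x ⁻¹ ∙ s → Good x
        good-inverting {x} chosen inverting sx = fresh chosen , xx∉T chosen , yx∉T chosen
          , (λ p → contradiction (deduce 2 (λ s x → x ⊕ x ⊜ s ⊕ (⊝ x ⊕ (⊝ s ⊕ x)) ⟸ x ◂ s ⊕ x ⊜ ⊝ x ⊕ s)
              ≡.refl (s ∷ x ∷ []) sx) (xx∉sT chosen p))
          , (λ _ → inj₂ (inj₁ (deduce 2 (λ s x → x ⊕ (⊝ s ⊕ x) ⊜ ⊝ s ⟸ ⊝ s ◂ s ⊕ x ⊜ ⊝ x ⊕ s)
              ≡.refl (s ∷ x ∷ []) sx)))
          , (λ _ → inj₂ (inj₂ (inverting , inj₂ (deduce 2 (λ s x → ⊝ s ⊕ x ⊕ (⊝ s ⊕ x) ⊜ ⊝ s ⊕ ⊝ s ⟸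
              ⊝ s ⊕ ⊝ s ◂ s ⊕ x ⊜ ⊝ x ⊕ s) ≡.refl (s ∷ x ∷ []) sx))))

        -- Here the same three elements equal s⁻¹, s⁻¹x² and s⁻²x².
        good-centralizing : ∀ {x} → Chosen x → s ∙ x ≈ x ∙ s → Good x
        good-centralizing {x} chosen sx = fresh chosen , xx∉T chosen , yx∉T chosen
          , (λ _ → inj₂ (inj₁ (deduce 2 (λ s x → ⊝ x ⊕ (⊝ s ⊕ x) ⊜ ⊝ s ⟸ ⊝ x ⊕ ⊝ s ◂ x ⊕ s ⊜ s ⊕ x)
              ≡.refl (s ∷ x ∷ []) (sym sx))))
          , (λ p → contradiction (deduce 2 (λ s x → x ⊕ x ⊜ s ⊕ (x ⊕ (⊝ s ⊕ x)) ⟸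
              :ε ◂ x ⊕ s ⊜ s ⊕ x) ≡.refl (s ∷ x ∷ []) (sym sx)) (xx∉sT chosen p))
          , (λ p → contradiction (deduce 2 (λ s x → x ⊕ x ⊜ s ⊕ s ⊕ (⊝ s ⊕ x ⊕ (⊝ s ⊕ x)) ⟸
              :ε ◂ x ⊕ s ⊜ s ⊕ x) ≡.refl (s ∷ x ∷ []) (sym sx)) (xx∉ssT chosen p))

        -- The square needs no condition of its own: (s⁻¹x)² lies in T only if x s⁻¹x lies in sT.
        good-neither : ∀ {x} → Chosen x → x ⁻¹ ∙ (s ⁻¹ ∙ x) ∉ T → x ∙ (s ⁻¹ ∙ x) ∉ T ++ map (s ∙_) T → Good x
        good-neither {x} chosen φ∉ ψ∉ = fresh chosen , xx∉T chosen , yx∉T chosen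
          , (λ p → contradiction p φ∉)
          , (λ p → contradiction (Any.++⁺ˡ p) ψ∉)
          , (λ p → contradiction (Any.++⁺ʳ T (∈-resp (deduce 2 (λ s x → s ⊕ (⊝ s ⊕ x ⊕ (⊝ s ⊕ x)) ⊜ x ⊕ (⊝ s ⊕ x) ⟸ [])
              ≡.refl (s ∷ x ∷ [])) (Membership.∈-map⁺ setoid setoid ∙-congˡ p))) ψ∉)

        neither : ¬ Inverting s → ¬ Centralizing s → ∃ Good
        neither ¬inverting ¬centralizing = finish
          (choose (λ j 0<j j≤2K → a-free j 0<j (≤-trans j≤2K 2K≤)) (hits φ T ++ hits ψ (T ++ map (s ∙_) T))
            (All.++⁺ (hits-once φ T φ-injective) (hits-once ψ (T ++ map (s ∙_) T) ψ-injective)) few′)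
          where
          φ ψ : ℕ → Carrier
          φ i = power i a ⁻¹ ∙ (s ⁻¹ ∙ power i a)
          ψ i = power i a ∙ (s ⁻¹ ∙ power i a)

          φ-injective : ∀ i j → i < j → j ≤ K → ¬ φ i ≈ φ j
          φ-injective i j i<j j≤K eq = ¬centralizing (j ∸ i , m<n⇒0<n∸m i<j , ≤-trans (m∸n≤m j i) j≤K ,
            conj-injective s (power i a) (power-∸ˡ a (<⇒≤ i<j)) eq)

          ψ-injective : ∀ i j → i < j → j ≤ K → ¬ ψ i ≈ ψ j
          ψ-injective i j i<j j≤K eq = ¬inverting (j ∸ i , m<n⇒0<n∸m i<j , ≤-trans (m∸n≤m j i) j≤K ,
            twist-injective s (power i a) (power-∸ˡ a (<⇒≤ i<j)) (power-∸ʳ a (<⇒≤ i<j)) eq)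

          few′ : length (hits φ T ++ hits ψ (T ++ map (s ∙_) T)) ≤ n + n + n
          few′ = ≤-trans (length-++≤ (hits φ T) (hits≤ φ T T≤n)
            (hits≤ ψ (T ++ map (s ∙_) T) (length-++≤ T T≤n (translates s)))) (≤-reflexive (three n))

          finish : (∃ λ i → 0 < i × i ≤ K × Chosen (power i a) ×
                    All (λ P → ¬ P i) (hits φ T ++ hits ψ (T ++ map (s ∙_) T))) → ∃ Good
          finish (i , _ , _ , chosen , misses) = power i a , good-neither chosen
            (missed φ T (All.++⁻ˡ (hits φ T) misses))
            (missed ψ (T ++ map (s ∙_) T) (All.++⁻ʳ (hits φ T) misses))

      -- If s inverts or centralizes some small power of a, then x is taken among the powers
      -- of that one.  Otherwise x⁻¹s⁻¹x and x s⁻¹x take every value at most once for x among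
      -- the first K powers of a: the quotient of two such x with the same value would be
      -- centralized, respectively inverted, by s.
      good : ∃ Good
      good = case lem {Lift c (Inverting s)} of λ where
        (yes (lift inverting@(j , 0<j , j≤K , inverts))) →
          case choose (power-free 0<j j≤K) [] [] z≤n of λ where
            (i , _ , _ , chosen , _) → power i (power j a) , good-inverting chosen inverting (power-invert inverts i)
        (no ¬inverting) → case lem {Lift c (Centralizing s)} of λ where
          (yes (lift (j , 0<j , j≤K , commutes))) →
            case choose (power-free 0<j j≤K) [] [] z≤n of λ where
              (i , _ , _ , chosen , _) → power i (power j a) , good-centralizing chosen (power-commute commutes i)
          (no ¬centralizing) → neither (¬inverting ∘ lift) (¬centralizing ∘ lift)

-- Separating the labels by their triangle counts

module Separation {c ℓ} (em : ExcludedMiddle (lsuc (c ⊔ ℓ))) (G : Group c ℓ)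
    {n K : ℕ} (few : suc n * suc n + suc n * suc n + (n + n + n + (n + n + n)) < K)
    {a : Group.Carrier G} (a-free : Powers.TorsionFreeUpTo em G ((K + K) * K) a) where
  open Group G
  open Algebra.Properties.Group G
  open Data.List.Membership.Setoid setoid using (_∈_; _∉_)
  open Data.List.Membership.DecPropositional ℕ._≟_ using (_∈?_) renaming (_∈_ to _∈ℕ_; _∉_ to _∉ℕ_)
  open FreeGroupSolver G
  open Dicyclic em G using (lem; _≟_)
  open Triangles em G
  open Powers em G
  open Choice K a-free
  open Algebra.Properties.Monoid.Mult monoid
    renaming (_×_ to power; ×-homo-+ to power-+; ×-assocˡ to power-power; ×-congˡ to power-congˡ) using ()

  exceptional-resp : ∀ {s e e′} → e ≈ e′ → Exceptional s e → Exceptional s e′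
  exceptional-resp p (inj₁ q)                    = inj₁ (trans (sym p) q)
  exceptional-resp p (inj₂ (inj₁ q))             = inj₂ (inj₁ (trans (sym p) q))
  exceptional-resp p (inj₂ (inj₂ (i , inj₁ q)))  = inj₂ (inj₂ (i , inj₁ (trans (sym p) q)))
  exceptional-resp p (inj₂ (inj₂ (i , inj₂ q)))  = inj₂ (inj₂ (i , inj₂ (trans (sym p) q)))

  exceptional-⁻¹ : ∀ {s e} → Exceptional s e → Exceptional s (e ⁻¹)
  exceptional-⁻¹ (inj₁ q)                    = inj₂ (inj₁ (⁻¹-cong q))
  exceptional-⁻¹ (inj₂ (inj₁ q))             = inj₁ (trans (⁻¹-cong q) (⁻¹-involutive _))
  exceptional-⁻¹ (inj₂ (inj₂ (i , inj₁ q)))  =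
    inj₂ (inj₂ (i , inj₂ (trans (⁻¹-cong q) (⁻¹-anti-homo-∙ _ _))))
  exceptional-⁻¹ (inj₂ (inj₂ (i , inj₂ q)))  =
    inj₂ (inj₂ (i , inj₁ (trans (⁻¹-cong q) (trans (⁻¹-anti-homo-∙ _ _) (∙-cong (⁻¹-involutive _) (⁻¹-involutive _))))))

  SquareOf : Carrier → Carrier → Set ℓ
  SquareOf s e = e ≈ s ∙ s ⊎ e ≈ s ⁻¹ ∙ s ⁻¹

  -- If s inverts the j-th power of a, then e centralizes it. If e also inverted the i-th power, it
  -- would both centralize and invert the ij-th one, and the 2ij-th power of a would be trivial,
  -- although 2ij ≤ 2K².
  square-not-inverting : ∀ {s e} → Inverting s → SquareOf s e → ¬ Inverting e
  square-not-inverting {s} {e} (j , 0<j , j≤K , sb) sq (i , 0<i , i≤K , ea) =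
    a-free (i * j + i * j) (≤-trans (*-mono-≤ 0<i 0<j) (m≤m+n _ _))
      (≤-trans (≤-reflexive (double i j)) (*-mono-≤ (+-mono-≤ i≤K i≤K) j≤K))
      (trans (power-+ a (i * j) (i * j)) (deduce 2 (λ e p → p ⊕ p ⊜ :ε ⟸ p ◂ p ⊕ e ⊜ e ⊕ p & p ◂ e ⊕ p ⊜ ⊝ p ⊕ e)
        ≡.refl (e ∷ p ∷ []) (sym e-commutes) e-inverts))
    where
    double : ∀ i j → i * j + i * j ≡ (i + i) * j
    double = solve-∀
    b = power j a
    p = power (i * j) a
    e-b : SquareOf s e → e ∙ b ≈ b ∙ e
    e-b (inj₁ q) = trans (∙-congʳ q) (trans
      (deduce 2 (λ s b → s ⊕ s ⊕ b ⊜ b ⊕ (s ⊕ s) ⟸ s ◂ s ⊕ b ⊜ ⊝ b ⊕ s & b ◂ ⊝ b ⊕ s ⊜ s ⊕ b)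
        ≡.refl (s ∷ b ∷ []) sb (sym sb)) (∙-congˡ (sym q)))
    e-b (inj₂ q) = trans (∙-congʳ q) (trans
      (deduce 2 (λ s b → ⊝ s ⊕ ⊝ s ⊕ b ⊜ b ⊕ (⊝ s ⊕ ⊝ s) ⟸
         ⊝ s ⊕ ⊝ s ⊕ b ◂ s ⊕ b ⊜ ⊝ b ⊕ s & ⊝ s ◂ ⊝ b ⊕ s ⊜ s ⊕ b)
        ≡.refl (s ∷ b ∷ []) sb (sym sb)) (∙-congˡ (sym q)))
    e-commutes : e ∙ p ≈ p ∙ e
    e-commutes = trans (∙-congˡ (sym (power-power a i j)))
      (trans (power-commute (e-b sq) i) (∙-congʳ (power-power a i j)))
    e-inverts : e ∙ p ≈ p ⁻¹ ∙ e
    e-inverts = trans (∙-congˡ (sym p≈)) (trans (power-invert ea j) (∙-congʳ (⁻¹-cong p≈)))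
      where
      p≈ : power j (power i a) ≈ p
      p≈ = trans (power-power a j i) (power-congˡ (ℕ.*-comm j i))

  module _ (L : List Carrier) (nontrivial : ∀ {s} → s ∈ L → ¬ s ≈ ε) where

    Colour : Carrier → Set (c ⊔ ℓ)
    Colour t = t ∈ L ⊎ t ⁻¹ ∈ L

    -- Later extensions for s affect only s, s² and their inverses. As an added element is not the
    -- square of a label or of its inverse, its count stays at most 6, unless it is itself a label
    -- up to inversion.
    record Admissible (T : List Carrier) : Set (c ⊔ ℓ) where
      field
        T-sym    : SymmetricList T
        ε∉T      : ε ∉ T
        coloured : ∀ {s} → s ∈ L → s ∈ T
        faint    : ∀ {t} → t ∈ T → Colour t ⊎ (N T t ≤ 6 × (∀ {s} → s ∈ L → ¬ SquareOf s t))

    record Improvement (s : Carrier) (T T′ : List Carrier) (size : ℕ) : Set (c ⊔ ℓ) where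
      field
        admissible : Admissible T′
        unchanged  : ∀ {e} → e ∈ L → ¬ Exceptional s e → N T′ e ≡ N T e
        bounded    : length T′ ≤ length T + size

    step : ∀ {s T} → Admissible T → s ∈ L → length T ≤ n →
           ∃ λ T′ → Improvement s T T′ 4 × N T s < N T′ s
    step {s} {T} adm s∈L T≤n = extend (good T-sym (coloured s∈L) T≤n few)
      where
      open Admissible adm
      extend : ∃ (Good T-sym (coloured s∈L) T≤n few) → ∃ λ T′ → Improvement s T T′ 4 × N T s < N T′ s
      extend (x , fresh , xx , yx , x⁻¹y , xy , yy) = T′ , record
        { admissible = record
            { T-sym    = T′-sym
            ; ε∉T      = ε∉T′
            ; coloured = λ p → Any.++⁺ʳ new (coloured p)
            ; faint    = λ p → [ faint-new , faint-old ]′ (Any.++⁻ new p)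
            }
        ; unchanged  = λ p ¬exc → N-old (coloured p) ¬exc
        ; bounded    = ≤-reflexive (ℕ.+-comm 4 (length T))
        } , N-grow
        where
        open Extension T-sym ε∉T (coloured s∈L) fresh {Exceptional s}
          exceptional-resp exceptional-⁻¹ (inj₁ refl) xx yx x⁻¹y xy yy

        faint-new : ∀ {t} → t ∈ new → Colour t ⊎ (N T′ t ≤ 6 × (∀ {s} → s ∈ L → ¬ SquareOf s t))
        faint-new p = inj₂ (N-new p , λ r → λ where
          (inj₁ q) → new-fresh p (there (coloured r)) (there (coloured r)) q
          (inj₂ q) → new-fresh p (there (T-sym (coloured r))) (there (T-sym (coloured r))) q)

        faint-old : ∀ {t} → t ∈ T → Colour t ⊎ (N T′ t ≤ 6 × (∀ {s} → s ∈ L → ¬ SquareOf s t))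
        faint-old {t} p with faint p
        ... | inj₁ colour         = inj₁ colour
        ... | inj₂ (N≤6 , nosq) with lem {Lift c (Exceptional s t)}
        ...   | no ¬exc                            =
                  inj₂ (≤-trans (≤-reflexive (N-old p (¬exc ∘ lift))) N≤6 , nosq)
        ...   | yes (lift (inj₁ q))                = inj₁ (inj₁ (∈-resp (sym q) s∈L))
        ...   | yes (lift (inj₂ (inj₁ q)))         =
                  inj₁ (inj₂ (∈-resp (sym (trans (⁻¹-cong q) (⁻¹-involutive s))) s∈L))
        ...   | yes (lift (inj₂ (inj₂ (_ , sq))))  = contradiction sq (nosq s∈L)

    -- Each extension raises the count of s, so a forbidden value once passed never returns; B
    -- contains those that may still be met, and k bounds the number of extensions. The 4 on the
    -- right accounts for n bounding T only before an extension.
    improve : ∀ {s} → s ∈ L → ∀ forbidden k B {T} → length B ≤ k → Admissible T → length T + 4 * k ≤ n + 4 →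
              (∀ {v} → v ∈ℕ forbidden → N T s ≤ v → v ∈ℕ B) →
              ∃ λ T′ → Improvement s T T′ (4 * k) × N T′ s ∉ℕ forbidden
    improve {s} s∈L forbidden k B {T} B≤k adm room covers with N T s ∈? forbidden
    ... | no ∉forbidden = T , record
            { admissible = adm ; unchanged = λ _ _ → ≡.refl ; bounded = m≤m+n _ _ } , ∉forbidden
    improve s∈L forbidden zero    []      B≤k adm room covers | yes ∈forbidden
      with () ← covers ∈forbidden ≤-refl
    improve {s} s∈L forbidden (suc k) B {T} B≤k adm room covers | yes ∈forbidden = continue (step adm s∈L T≤n)
      where
      shift : ∀ t k → t + 4 * suc k ≡ t + 4 + 4 * k
      shift = solve-∀

      T≤n : length T ≤ n
      T≤n = +-cancelʳ-≤ 4 _ _ (≤-trans (≤-trans (m≤m+n _ _) (≤-reflexive (≡.sym (shift (length T) k)))) room)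

      continue : (∃ λ T′ → Improvement s T T′ 4 × N T s < N T′ s) →
                 ∃ λ T′ → Improvement s T T′ (4 * suc k) × N T′ s ∉ℕ forbidden
      continue (T₁ , imp₁ , grow) = finish (improve s∈L forbidden k (filter (λ v → ¬? (v ℕ.≟ N T s)) B)
          (ℕ.≤-pred (≤-trans (filter-notAll (λ v → ¬? (v ℕ.≟ N T s)) B
            (Any.map (λ eq ne → ne (≡.sym eq)) (covers ∈forbidden ≤-refl))) B≤k))
          admissible
          (≤-trans (+-monoˡ-≤ (4 * k) bounded) (≤-trans (≤-reflexive (≡.sym (shift (length T) k))) room))
          (λ v∈ N≤v → Membershipₚ.∈-filter⁺ (λ v → ¬? (v ℕ.≟ N T s)) (covers v∈ (≤-trans (<⇒≤ grow) N≤v))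
            λ eq → <-irrefl ≡.refl (<-≤-trans grow (≤-trans N≤v (≤-reflexive eq)))))
        where
        open Improvement imp₁
        finish : (∃ λ T′ → Improvement s T₁ T′ (4 * k) × N T′ s ∉ℕ forbidden) →
                 ∃ λ T′ → Improvement s T T′ (4 * suc k) × N T′ s ∉ℕ forbidden
        finish (T₂ , imp₂ , ∉forbidden) = T₂ , record
          { admissible = Improvement.admissible imp₂
          ; unchanged  = λ p ¬exc → ≡.trans (Improvement.unchanged imp₂ p ¬exc) (unchanged p ¬exc)
          ; bounded    = ≤-trans (Improvement.bounded imp₂) (≤-trans (+-monoˡ-≤ (4 * k) bounded)
                           (≤-reflexive (≡.sym (shift (length T) k))))
          } , ∉forbidden

    -- Treating s may change the count of s² as well, so that s must come before s².
    Before : Carrier → Carrier → Set ℓ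
    Before d s = ¬ (Inverting s × SquareOf s d)

    Treated : List Carrier → Carrier → Set (c ⊔ ℓ)
    Treated D s = s ∈ D ⊎ s ⁻¹ ∈ D

    record Separated (T D : List Carrier) : Set (c ⊔ ℓ) where
      field
        admissible : Admissible T
        subset     : ∀ {d} → d ∈ D → d ∈ L
        bright     : ∀ {d} → d ∈ D → 6 < N T d
        distinct   : ∀ {d d′} → d ∈ D → d′ ∈ D → N T d ≡ N T d′ → d ≈ d′

    private
      squareOf-resp : ∀ {s d d′} → d ≈ d′ → SquareOf s d′ → SquareOf s d
      squareOf-resp p (inj₁ q) = inj₁ (trans p q)
      squareOf-resp p (inj₂ q) = inj₂ (trans p q)

      -- The (k + 1)-st colour must avoid the counts 0, …, 6 and k others, and each step
      -- adds four elements.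
      cost : ℕ → ℕ → ℕ
      cost k zero    = 0
      cost k (suc l) = 4 * (7 + k) + cost (suc k) l

      cost-suc : ∀ k l → cost k l ≤ cost (suc k) l
      cost-suc k zero    = z≤n
      cost-suc k (suc l) = +-mono-≤ (*-monoʳ-≤ 4 (ℕ.n≤1+n (7 + k))) (cost-suc (suc k) l)

      -- In closed form the cost is 28l + 4kl + 2l² - 2l. The negative term is moved to the left,
      -- where for k = 0 it matches the 2l elements of the initial set.
      cost-formula : ∀ k l → cost k l + 2 * l ≡ 28 * l + 4 * k * l + 2 * l * l
      cost-formula k zero    = zero-case k
        where
        zero-case : ∀ k → 0 ≡ 28 * 0 + 4 * k * 0 + 2 * 0 * 0
        zero-case = solve-∀
      cost-formula k (suc l) = ≡.trans (split k l (cost (suc k) l))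
        (≡.trans (≡.cong (4 * (7 + k) + 2 +_) (cost-formula (suc k) l)) (join k l))
        where
        split : ∀ k l r → 4 * (7 + k) + r + 2 * suc l ≡ 4 * (7 + k) + 2 + (r + 2 * l)
        split = solve-∀
        join : ∀ k l → 4 * (7 + k) + 2 + (28 * l + 4 * suc k * l + 2 * l * l) ≡
                       28 * suc l + 4 * k * suc l + 2 * suc l * suc l
        join = solve-∀

      record Outcome (M D T : List Carrier) : Set (c ⊔ ℓ) where
        constructor outcome
        field
          {T′ D′}   : List Carrier
          separated : Separated T′ D′
          extends   : ∀ {d} → d ∈ D → d ∈ D′
          treated   : All (Treated D′) M
          bounded   : length T′ ≤ length T + cost (length D) (length M)

    -- Treating s leaves the counts of the labels in D unchanged: they differ from s and s⁻¹, as s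
    -- is untreated, and the order rules out s² and s⁻² when s is inverting. A label that repeats an
    -- earlier one up to inversion is skipped.
    separate : ∀ M {D T} → Separated T D → All (_∈ L) M → AllPairs Before M → (∀ {d} → d ∈ D → All (Before d) M) →
               length T + cost (length D) (length M) ≤ n + 4 →
               Outcome M D T
    separate []      sep _ _ _ _ = outcome sep (λ p → p) [] (m≤m+n _ _)
    separate (s ∷ M) {D} {T} sep (s∈L ∷ M⊆L) (s-before ∷ ordered) D-before room with lem {Treated D s}
    ... | yes treated = skip (separate M sep M⊆L ordered (All.tail ∘ D-before)
          (≤-trans (+-monoʳ-≤ (length T) saved) room))
      where
      saved : cost (length D) (length M) ≤ cost (length D) (suc (length M))
      saved = ≤-trans (cost-suc (length D) (length M)) (m≤n+m _ (4 * (7 + length D)))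

      skip : Outcome M D T → Outcome (s ∷ M) D T
      skip (outcome sep′ D⊆D′ all bound) = outcome sep′ D⊆D′ ([ inj₁ ∘ D⊆D′ , inj₂ ∘ D⊆D′ ]′ treated ∷ all)
        (≤-trans bound (+-monoʳ-≤ (length T) saved))
    ... | no untreated = continue (improve s∈L forbidden (7 + length D) forbidden forbidden≤ admissible
        (≤-trans (+-monoʳ-≤ (length T) (m≤m+n _ _)) room) (λ p _ → p))
      where
      open Separated sep
      forbidden : List ℕ
      forbidden = upTo 7 ++ map (N T) D

      forbidden≤ : length forbidden ≤ 7 + length D
      forbidden≤ = s≤s (s≤s (s≤s (s≤s (s≤s (s≤s (s≤s (≤-reflexive (length-map (N T) D))))))))

      unexceptional : ∀ {d} → d ∈ D → ¬ Exceptional s d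
      unexceptional p (inj₁ q)               = untreated (inj₁ (∈-resp q p))
      unexceptional p (inj₂ (inj₁ q))        = untreated (inj₂ (∈-resp q p))
      unexceptional p (inj₂ (inj₂ inv-sq))   = All.head (D-before p) inv-sq

      continue : (∃ λ T₁ → Improvement s T T₁ (4 * (7 + length D)) × N T₁ s ∉ℕ forbidden) → Outcome (s ∷ M) D T
      continue (T₁ , imp , ∉forbidden) =
        finish (separate M sep₁ M⊆L ordered before₁ (≤-trans size room))
        where
        open Improvement imp using (unchanged; bounded)
        size : length T₁ + cost (suc (length D)) (length M) ≤
               length T + (4 * (7 + length D) + cost (suc (length D)) (length M))
        size = ≤-trans (+-monoˡ-≤ _ bounded) (≤-reflexive (ℕ.+-assoc (length T) _ _))

        finish : Outcome M (s ∷ D) T₁ → Outcome (s ∷ M) D T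
        finish (outcome sep′ D⊆D′ all bound) =
          outcome sep′ (λ p → D⊆D′ (there p)) (inj₁ (D⊆D′ (here refl)) ∷ all) (≤-trans bound size)

        N-D : ∀ {d} → d ∈ D → N T₁ d ≡ N T d
        N-D p = unchanged (subset p) (unexceptional p)

        fresh-value : ∀ {d} → d ∈ D → ¬ N T₁ s ≡ N T₁ d
        fresh-value p eq = ∉forbidden (Any.++⁺ʳ (upTo 7) (≡.subst (_∈ℕ map (N T) D) (≡.sym (≡.trans eq (N-D p)))
          (Membership.∈-map⁺ setoid ((≡.setoid ℕ)) N-resp p)))

        before₁ : ∀ {d} → d ∈ s ∷ D → All (Before d) M
        before₁ (here p)  = All.map (λ b (i , sq) → b (i , squareOf-resp (sym p) sq)) s-before
        before₁ (there p) = All.tail (D-before p)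

        sep₁ : Separated T₁ (s ∷ D)
        sep₁ = record
          { admissible = Improvement.admissible imp
          ; subset     = λ where
              (here p)  → ∈-resp (sym p) s∈L
              (there p) → subset p
          ; bright     = λ where
              (here p)  → ≡.subst (6 <_) (≡.sym (N-resp p))
                (≰⇒> λ N≤6 → ∉forbidden (Any.++⁺ˡ (Membershipₚ.∈-upTo⁺ (s≤s N≤6))))
              (there p) → ≡.subst (6 <_) (≡.sym (N-D p)) (bright p)
          ; distinct   = λ where
              (here p)  (here q)  _  → trans p (sym q)
              (here p)  (there q) eq → contradiction (≡.trans (≡.sym (N-resp p)) eq) (fresh-value q)
              (there p) (here q)  eq → contradiction (≡.trans (≡.sym (N-resp q)) (≡.sym eq)) (fresh-value p)
              (there p) (there q) eq → distinct p q (≡.trans (≡.sym (N-D p)) (≡.trans eq (N-D q)))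
          }

    private
      initial : List Carrier
      initial = L ++ map _⁻¹ L

      ∈-inverses : ∀ {x} → x ∈ map _⁻¹ L → x ⁻¹ ∈ L
      ∈-inverses p with Membership.∈-map⁻ setoid setoid p
      ... | y , y∈L , x≈y⁻¹ = ∈-resp (sym (trans (⁻¹-cong x≈y⁻¹) (⁻¹-involutive y))) y∈L

      initial-admissible : Admissible initial
      initial-admissible = record
        { T-sym    = λ p → [ (λ q → Any.++⁺ʳ L (Membership.∈-map⁺ setoid setoid ⁻¹-cong q))
                           , (λ q → Any.++⁺ˡ (∈-inverses q)) ]′ (Any.++⁻ L p)
        ; ε∉T      = λ p → [ (λ q → nontrivial q refl)
                           , (λ q → nontrivial (∈-inverses q) ε⁻¹≈ε) ]′ (Any.++⁻ L p)
        ; coloured = Any.++⁺ˡ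
        ; faint    = λ p → inj₁ ([ inj₁ , inj₂ ∘ ∈-inverses ]′ (Any.++⁻ L p))
        }

      initial-size : length initial ≡ 2 * length L
      initial-size = ≡.trans (length-++ L) (≡.trans (≡.cong (length L +_) (length-map _⁻¹ L)) (double (length L)))
        where
        double : ∀ m → m + m ≡ 2 * m
        double = solve-∀

      total-size : length initial + cost 0 (length L) ≡ 2 * length L * length L + 28 * length L
      total-size = ≡.trans (≡.cong (_+ cost 0 (length L)) initial-size)
        (≡.trans (ℕ.+-comm (2 * length L) _) (≡.trans (cost-formula 0 (length L)) (arrange (length L))))
        where
        arrange : ∀ l → 28 * l + 4 * 0 * l + 2 * l * l ≡ 2 * l * l + 28 * l
        arrange = solve-∀

    private
      conclude : Outcome L [] initial → ColourSeparation L
      conclude (outcome {T} {D} sep _ treated bound) = record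
        { T-sym      = T-sym
        ; ε∉T        = ε∉T
        ; coloured   = λ p _ → coloured p
        ; determined = λ p _ → determined p
        ; bounded    = ≤-trans bound (≤-reflexive total-size)
        }
        where
        open Separated sep
        open Admissible admissible

        L-treated : ∀ {s} → s ∈ L → Treated D s
        L-treated = All.lookupₛ setoid (λ x≈y → λ where
          (inj₁ p) → inj₁ (∈-resp x≈y p)
          (inj₂ p) → inj₂ (∈-resp (⁻¹-cong x≈y) p)) treated

        colour-treated : ∀ {t} → Colour t → Treated D t
        colour-treated (inj₁ p) = L-treated p
        colour-treated (inj₂ p) with L-treated p
        ... | inj₁ q = inj₂ q
        ... | inj₂ q = inj₁ (∈-resp (⁻¹-involutive _) q)

        treated-bright : ∀ {s} → Treated D s → 6 < N T s
        treated-bright (inj₁ p) = bright p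
        treated-bright (inj₂ p) = ≡.subst (6 <_) (N-⁻¹ T-sym _) (bright p)

        same-colour : ∀ {s t} → Treated D s → Treated D t → N T t ≡ N T s → t ≈ s ⊎ t ≈ s ⁻¹
        same-colour (inj₁ p) (inj₁ q) eq = inj₁ (distinct q p eq)
        same-colour (inj₂ p) (inj₁ q) eq = inj₂ (distinct q p (≡.trans eq (≡.sym (N-⁻¹ T-sym _))))
        same-colour (inj₁ p) (inj₂ q) eq =
          inj₂ (trans (sym (⁻¹-involutive _)) (⁻¹-cong (distinct q p (≡.trans (N-⁻¹ T-sym _) eq))))
        same-colour (inj₂ p) (inj₂ q) eq = inj₁ (⁻¹-injective
          (distinct q p (≡.trans (N-⁻¹ T-sym _) (≡.trans eq (≡.sym (N-⁻¹ T-sym _))))))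

        determined : ∀ {s t} → s ∈ L → t ∈ T → N T t ≡ N T s → t ≈ s ⊎ t ≈ s ⁻¹
        determined s∈L t∈T eq with faint t∈T
        ... | inj₁ colour      = same-colour (L-treated s∈L) (colour-treated colour) eq
        ... | inj₂ (N≤6 , _)   = contradiction
          (<-≤-trans (treated-bright (L-treated s∈L)) (≤-trans (≤-reflexive (≡.sym eq)) N≤6)) (n≮n 6)

    ordered-separation : AllPairs Before L → 2 * length L * length L + 28 * length L ≤ n + 4 → ColourSeparation L
    ordered-separation ordered room = conclude (separate L
      (record { admissible = initial-admissible ; subset = λ () ; bright = λ () ; distinct = λ () })
      (All.tabulateₛ setoid (λ p → p)) ordered (λ ()) (≤-trans (≤-reflexive total-size) room))

  private
    length-partition : ∀ {p} {P : Carrier → Set p} (P? : ∀ x → Dec (P x)) xs →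
                       length (filter P? xs ++ filter (λ x → ¬? (P? x)) xs) ≡ length xs
    length-partition P? xs = ≡.trans (length-++ (filter P? xs)) (go xs)
      where
      go : ∀ xs → length (filter P? xs) + length (filter (λ x → ¬? (P? x)) xs) ≡ length xs
      go []       = ≡.refl
      go (x ∷ xs) with P? x
      ... | yes _ = ≡.cong suc (go xs)
      ... | no  _ = ≡.trans (ℕ.+-suc _ _) (≡.cong suc (go xs))

  separation : ∀ X → 2 * length X * length X + 28 * length X ≤ n + 4 → ColourSeparation X
  separation X room = record
    { T-sym      = T-sym
    ; ε∉T        = ε∉T
    ; coloured   = λ p s≉ε → coloured (∈-L p s≉ε) s≉ε
    ; determined = λ p s≉ε → determined (∈-L p s≉ε) s≉ε
    ; bounded    = ≤-trans bounded small
    }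
    where
    nontrivial? : ∀ x → Dec (¬ x ≈ ε)
    nontrivial? x = ¬? (x ≟ ε)

    inverting? : ∀ x → Dec (Inverting x)
    inverting? x = map′ lower lift (lem {Lift c (Inverting x)})

    X′ I J L : List Carrier
    X′ = filter nontrivial? X
    I  = filter inverting? X′
    J  = filter (λ x → ¬? (inverting? x)) X′
    L  = I ++ J

    ≉ε-resp : ∀ {x y} → x ≈ y → ¬ x ≈ ε → ¬ y ≈ ε
    ≉ε-resp x≈y x≉ε y≈ε = x≉ε (trans x≈y y≈ε)

    inverting-resp : ∀ {x y} → x ≈ y → Inverting x → Inverting y
    inverting-resp x≈y (j , 0<j , j≤K , p) =
      j , 0<j , j≤K , trans (∙-congʳ (sym x≈y)) (trans p (∙-congˡ x≈y))

    ¬inverting-resp : ∀ {x y} → x ≈ y → ¬ Inverting x → ¬ Inverting y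
    ¬inverting-resp x≈y ¬i i = ¬i (inverting-resp (sym x≈y) i)

    nontrivial : ∀ {s} → s ∈ L → ¬ s ≈ ε
    nontrivial p = proj₂ (Membership.∈-filter⁻ setoid nontrivial? ≉ε-resp {xs = X}
      ([ (λ q → proj₁ (Membership.∈-filter⁻ setoid inverting? inverting-resp {xs = X′} q))
       , (λ q → proj₁ (Membership.∈-filter⁻ setoid (λ x → ¬? (inverting? x)) ¬inverting-resp {xs = X′} q)) ]′ (Any.++⁻ I p)))

    ∈-L : ∀ {s} → s ∈ X → ¬ s ≈ ε → s ∈ L
    ∈-L {s} p s≉ε = case inverting? s of λ where
        (yes i) → Any.++⁺ˡ (Membership.∈-filter⁺ setoid inverting? inverting-resp p′ i)
        (no ¬i) → Any.++⁺ʳ I (Membership.∈-filter⁺ setoid (λ x → ¬? (inverting? x)) ¬inverting-resp p′ ¬i)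
      where
      p′ : s ∈ X′
      p′ = Membership.∈-filter⁺ setoid nontrivial? ≉ε-resp p s≉ε

    allPairs : ∀ {p r} {P : Carrier → Set p} {R : Carrier → Carrier → Set r} →
               (∀ {x y} → P x → P y → R x y) → ∀ {xs} → All P xs → AllPairs R xs
    allPairs r []       = []
    allPairs r (p ∷ ps) = All.map (r p) ps ∷ allPairs r ps

    -- A label can be spoilt only by a later inverting label of which it is the square up to
    -- inversion. As the inverting labels come first, it would then be inverting itself, contrary to
    -- `square-not-inverting`.
    sorted : AllPairs (Before L nontrivial) L
    sorted = AllPairs.++⁺
      (allPairs (λ i _ (j , sq) → square-not-inverting j sq i) (All.all-filter inverting? X′))
      (allPairs (λ _ ¬i (i , _) → ¬i i) (All.all-filter (λ x → ¬? (inverting? x)) X′))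
      (All.universal (λ _ → All.map (λ ¬i (i , _) → ¬i i) (All.all-filter (λ x → ¬? (inverting? x)) X′)) I)

    L≤X : length L ≤ length X
    L≤X = ≤-trans (≤-reflexive (length-partition inverting? X′)) (length-filter nontrivial? X)

    small : 2 * length L * length L + 28 * length L ≤ 2 * length X * length X + 28 * length X
    small = +-mono-≤ (*-mono-≤ (*-monoʳ-≤ 2 L≤X) L≤X) (*-monoʳ-≤ 28 L≤X)

    open ColourSeparation (ordered-separation L nontrivial sorted (≤-trans small room))

-- From separated labels to a graphical regular representation

module CayleyGraphs {c ℓ} (em : ExcludedMiddle (lsuc (c ⊔ ℓ))) (G : Group c ℓ) where
  open Group G
  open Algebra.Properties.Group G
  open Data.List.Membership.Setoid setoid using (_∈_)
  open FreeGroupSolver G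
  open Dicyclic em G using (_≟_)
  open Triangles em G

  GRRExtension : Subset G → ℕ → Set (lsuc (c ⊔ ℓ))
  GRRExtension S b = ∃ λ (T : Subset G) → ∃ λ (T-gen : IsGeneratingSet G T) → ∃ λ t →
    IsSymmetricSet G T × S ⊆ T × IsGRR G (Cay G T T-gen) × HasSize G T t × t ≤ b

  hasValency : ∀ {T t} (T-gen : IsGeneratingSet G T) → IsSymmetricSet G T → HasSize G T t →
               HasValency (Cay G T T-gen) t
  hasValency {T} T-gen (_ , T⁻¹⊆T) (ts , unique , T⇔ts , size) x =
    map (x ∙_) ts
    , Uniqueₛ.map⁺ setoid setoid (λ p → ∙-cancelˡ x _ _ p) unique
    , (λ y → mk⇔
        (λ p → Membership.∈-resp-≈ setoid (\\-leftDividesˡ x y)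
          (Membership.∈-map⁺ setoid setoid ∙-congˡ (Equivalence.to (T⇔ts _) ([ (λ q → q) , T⁻¹⊆T ]′ p))))
        (λ p → let t , t∈ts , y≈xt = Membership.∈-map⁻ setoid setoid p in
          inj₁ (IsGeneratingSet.resp-≈ T-gen
            (deduce 3 (λ x t y → t ⊜ ⊝ x ⊕ y ⟸ ⊝ x ◂ x ⊕ t ⊜ y) ≡.refl (x ∷ t ∷ y ∷ []) (sym y≈xt))
            (Equivalence.from (T⇔ts t) t∈ts))))
    , ≡.trans (length-map (x ∙_) ts) size

  hasGRR : ∀ {S b} → GRRExtension S b → HasGRROfValencyAtMost G b
  hasGRR (T , T-gen , t , T-sym , _ , grr , size , t≤b) =
    T , T-gen , grr , t , hasValency T-gen T-sym size , t≤b

  module _ {S : Subset G} (generates : ∀ x → Generated G S x) {X : List Carrier} (separation : ColourSeparation X) where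
    open ColourSeparation separation

    module _ (S⊆T : ∀ {s} → S s → s ∈ T) where

      generated-mono : ∀ {x} → Generated G S x → Generated G (_∈ T) x
      generated-mono (gen p)    = gen (S⊆T p)
      generated-mono unit       = unit
      generated-mono (mul p q)  = mul (generated-mono p) (generated-mono q)
      generated-mono (inv p)    = inv (generated-mono p)
      generated-mono (resp e p) = resp e (generated-mono p)

      T-generating : IsGeneratingSet G (_∈ T)
      T-generating = record { resp-≈ = ∈-resp ; ε∉ = ε∉T ; generates = generated-mono ∘ generates }

      T-symmetric : IsSymmetricSet G (_∈ T)
      T-symmetric = T-sym , λ p → ∈-resp (⁻¹-involutive _) (T-sym p)

      T-size : HasSize G (_∈ T) (length (deduplicate _≟_ T))
      T-size = deduplicate _≟_ T , Unique.deduplicate-! decSetoid T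
        , (λ x → mk⇔ (Membership.∈-deduplicate⁺ setoid _≟_ (λ p q → trans q (sym p)))
                     (Membership.∈-deduplicate⁻ setoid _≟_ T)) , ≡.refl

      module _ {f : Carrier → Carrier} (aut : IsGraphAutomorphism (Cay G (_∈ T) T-generating) f) where
        open IsGraphAutomorphism aut
        open Rigidity G cong

        private
          adjacent : ∀ {g h} → (g ⁻¹ ∙ h ∈ T ⊎ (g ⁻¹ ∙ h) ⁻¹ ∈ T) → g ⁻¹ ∙ h ∈ T
          adjacent (inj₁ p) = p
          adjacent (inj₂ p) = ∈-resp (⁻¹-involutive _) (T-sym p)

          image : ∀ {g h} → g ⁻¹ ∙ h ∈ T → f g ⁻¹ ∙ f h ∈ T
          image p = adjacent (Equivalence.to (adj _ _) (inj₁ p))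

          preimage : ∀ {g h} → f g ⁻¹ ∙ f h ∈ T → g ⁻¹ ∙ h ∈ T
          preimage p = adjacent (Equivalence.from (adj _ _) (inj₁ p))

          injective : ∀ {x y} → f x ≈ f y → x ≈ y
          injective = proj₁ bijective

          module _ (g e : Carrier) where
            d : Carrier
            d = f g ⁻¹ ∙ f (g ∙ e)

            -- The automorphism sends the third vertex gu of a triangle on the edge from g to ge to
            -- a third vertex on the image edge, whose label is d. The reverse inequality uses its
            -- surjectivity.
            N-image : N T e ≤ N T d
            N-image = N-≤ {R = λ u v → f g ∙ v ≈ f (g ∙ u)}
              (λ v≈v′ p → trans (∙-congˡ (sym v≈v′)) p)
              (λ p q → ∙-cancelˡ g _ _ (injective (trans (sym p) q)))
              λ {u} (p , q) → f g ⁻¹ ∙ f (g ∙ u)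
                , ( image (∈-resp (sym (\\-leftDividesʳ g u)) p)
                  , ∈-resp (deduce 3 (λ a b c → ⊝ b ⊕ c ⊜ ⊝ (⊝ a ⊕ b) ⊕ (⊝ a ⊕ c) ⟸ [])
                      ≡.refl (f g ∷ f (g ∙ u) ∷ f (g ∙ e) ∷ []))
                      (image (∈-resp (deduce 3 (λ g u e → ⊝ u ⊕ e ⊜ ⊝ (g ⊕ u) ⊕ (g ⊕ e) ⟸ [])
                        ≡.refl (g ∷ u ∷ e ∷ [])) q)) )
                , \\-leftDividesˡ (f g) _

            N-preimage : N T d ≤ N T e
            N-preimage = N-≤ {R = λ v u → f (g ∙ u) ≈ f g ∙ v}
              (λ u≈u′ p → trans (cong (∙-congˡ (sym u≈u′))) p)
              (λ p q → ∙-cancelˡ (f g) _ _ (trans (sym p) q))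
              λ {v} (p , q) → let
                h , surj = proj₂ bijective (f g ∙ v)
                fh = surj refl
              in g ⁻¹ ∙ h
                , ( preimage (∈-resp (trans (sym (\\-leftDividesʳ (f g) v)) (∙-congˡ (sym fh))) p)
                  , ∈-resp (deduce 3 (λ g h e → ⊝ h ⊕ (g ⊕ e) ⊜ ⊝ (⊝ g ⊕ h) ⊕ e ⟸ []) ≡.refl (g ∷ h ∷ e ∷ []))
                      (preimage (∈-resp (trans
                        (deduce 3 (λ v a b → ⊝ v ⊕ (⊝ a ⊕ b) ⊜ ⊝ (a ⊕ v) ⊕ b ⟸ []) ≡.refl (v ∷ f g ∷ f (g ∙ e) ∷ []))
                        (∙-congʳ (⁻¹-cong (sym fh)))) q)) )
                , trans (cong (\\-leftDividesˡ g h)) fh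

        preserves-colour : ∀ {e} → e ∈ X → PreservesColour e
        preserves-colour {e} e∈X g = case e ≟ ε of λ where
          (yes e≈ε) → inj₁ (trans (cong (trans (∙-congˡ e≈ε) (identityʳ g)))
                              (sym (trans (∙-congˡ e≈ε) (identityʳ (f g)))))
          (no e≉ε)  → case determined e∈X e≉ε (image (∈-resp (sym (\\-leftDividesʳ g e)) (coloured e∈X e≉ε)))
                        (≤-antisym (N-preimage g e) (N-image g e)) of λ where
            (inj₁ p) → inj₁ (trans (sym (\\-leftDividesˡ (f g) _)) (∙-congˡ p))
            (inj₂ p) → inj₂ (trans (sym (\\-leftDividesˡ (f g) _)) (∙-congˡ p))

        left-multiplication : (All PreservesColour X → ∀ {s} → S s → CommutesWith s) → ∃ λ g → ∀ x → f x ≈ g ∙ x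
        left-multiplication rigid = f ε , λ x →
          trans (cong (sym (identityˡ x))) (generated (rigid (All.tabulateₛ setoid preserves-colour)) (generates x) ε)

  open Powers em G

  module Bound (n : ℕ) where
    -- The least value that `Separation` admits for n.
    K : ℕ
    K = suc (suc n * suc n + suc n * suc n + (n + n + n + (n + n + n)))

    grr-extension : ¬ IsAbelian G → ∀ {k} → 1 ≤ k →
      (∀ {s} → ¬ Colours.Central em G s → ∃ λ L → length L ≤ k × Colours.Determines em G (s ∷ L) s) →
      ∀ {a} → TorsionFreeUpTo ((K + K) * K) a →
      ∀ {S r} → IsGeneratingSet G S → HasSize G S r → let m = suc k * r in
      2 * m * m + 28 * m ≤ n + 4 → GRRExtension S (2 * m * m + 28 * m)
    grr-extension nonabelian {k} 1≤k nc-colours {a} a-free {S} S-gen (xs , _ , S⇔xs , ≡.refl) room =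
      conclude (Colours.generator-colours em G nonabelian 1≤k nc-colours (IsGeneratingSet.generates S-gen)
        (λ {s} → Equivalence.to (S⇔xs s)))
      where
      open IsGeneratingSet S-gen using (generates; ε∉; resp-≈)
      size : ℕ → ℕ
      size m = 2 * m * m + 28 * m

      size-mono : ∀ {l m} → l ≤ m → size l ≤ size m
      size-mono l≤m = ℕ.+-mono-≤ (ℕ.*-mono-≤ (ℕ.*-monoʳ-≤ 2 l≤m) l≤m) (ℕ.*-monoʳ-≤ 28 l≤m)

      conclude : (∃ λ X → length X ≤ suc k * length xs × (∀ {x} → x ∈ xs → x ∈ X) ×
        (∀ f (f-cong : Congruent _≈_ _≈_ f) → All (Rigidity.PreservesColour G {f} f-cong) X →
          ∀ {x} → x ∈ xs → Rigidity.CommutesWith G {f} f-cong x)) → GRRExtension S (size (suc k * length xs))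
      conclude (X , X≤ , xs⊆X , rigid) = (_∈ T) , T-generating generates sep S⊆T , _
        , T-symmetric generates sep S⊆T , S⊆T
        , (λ f aut → left-multiplication generates sep S⊆T aut
             (λ ps {s} Ss → rigid f (IsGraphAutomorphism.cong aut) ps (Equivalence.to (S⇔xs s) Ss)))
        , T-size generates sep S⊆T
        , ≤-trans (length-deduplicate _≟_ T) (≤-trans bounded (size-mono X≤))
        where
        sep : ColourSeparation X
        sep = Separation.separation em G {n} {K} ≤-refl {a} a-free X (≤-trans (size-mono X≤) room)
        open ColourSeparation sep
        S⊆T : ∀ {s} → S s → s ∈ T
        S⊆T {s} Ss = coloured (xs⊆X (Equivalence.to (S⇔xs s) Ss)) λ s≈ε → ε∉ (resp-≈ s≈ε Ss)

-- Numerical bounds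

module Orders {c ℓ} (em : ExcludedMiddle (lsuc (c ⊔ ℓ))) (G : Group c ℓ) where
  open Group G
  open Data.List.Membership.Setoid setoid using (_∈_)
  open CayleyGraphs em G
  open Powers em G using (TorsionFreeUpTo; torsionFreeUpTo)
  open Colours em G

  private
    module _ (j : ℕ) where
      n : ℕ
      n = 4 + j

      open Bound n using (K)

      -- These are 2n² + 3n - 2 and 2n² + 4n - 1 expanded in j, which removes the truncated
      -- subtractions from F.
      p q : ℕ
      p = 42 + (19 * j + 2 * (j * j))
      q = 47 + (20 * j + 2 * (j * j))

      p-eq : ∀ j → 2 * ((4 + j) * ((4 + j) * 1)) + 3 * (4 + j) ≡ 2 + (42 + (19 * j + 2 * (j * j)))
      p-eq = solve-∀

      q-eq : ∀ j → 2 * ((4 + j) * ((4 + j) * 1)) + 4 * (4 + j) ≡ 1 + (47 + (20 * j + 2 * (j * j)))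
      q-eq = solve-∀

      F-eq : F n ≡ 2 * p ^ 2 * q
      F-eq = ≡.cong₂ (λ x y → 2 * (x ∸ 2) ^ 2 * (y ∸ 1)) (p-eq j) (q-eq j)

      -- In terms of n, the difference of 2p and K is 2n² - 4n - 7, which is negative at n = 3 and
      -- equals 9 at n = 4; hence the shift by 4.
      K-eq : ∀ j → suc (suc (4 + j) * suc (4 + j) + suc (4 + j) * suc (4 + j) +
                        (4 + j + (4 + j) + (4 + j) + (4 + j + (4 + j) + (4 + j)))) + (9 + (12 * j + 2 * (j * j)))
                   ≡ 2 * (42 + (19 * j + 2 * (j * j)))
      K-eq = solve-∀

      K≤2p : K ≤ 2 * p
      K≤2p = ≤-trans (m≤m+n K (9 + (12 * j + 2 * (j * j)))) (≤-reflexive (K-eq j))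

    double-square : ∀ {k p q} → k ≤ 2 * suc p → 4 < q → (k + k) * k < 2 * suc p ^ 2 * q
    double-square {k} {p} {q} k≤ 4<q = begin-strict
      (k + k) * k                                  ≤⟨ *-mono-≤ (+-mono-≤ k≤ k≤) k≤ ⟩
      (2 * suc p + 2 * suc p) * (2 * suc p)     ≡⟨ eight-squares (suc p) ⟩
      2 * suc p ^ 2 * 4                            <⟨ *-monoʳ-< (2 * suc p ^ 2) 4<q ⟩
      2 * suc p ^ 2 * q                            ∎
      where
      open ≤-Reasoning
      eight-squares : ∀ p → (2 * p + 2 * p) * (2 * p) ≡ 2 * (p * (p * 1)) * 4
      eight-squares = solve-∀

  -- From K ≤ 2p it follows that 2K² ≤ 8p², while F(n) = 2p²q with q > 4.
  2K²<F : ∀ {n} → 4 ≤ n → let open Bound n in (K + K) * K < F n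
  2K²<F {suc (suc (suc (suc j)))} (s≤s (s≤s (s≤s (s≤s _)))) =
    ℕ.<-≤-trans (double-square {Bound.K (4 + j)} {41 + (19 * j + 2 * (j * j))} {q j} (K≤2p j) (m≤m+n 5 (42 + (20 * j + 2 * (j * j)))))
      (≤-reflexive (≡.sym (F-eq j)))

  module _ (nondicyclic : ¬ IsGeneralizedDicyclic G) (nonabelian : ¬ IsAbelian G) where

    grr : ∀ {k} → 1 ≤ k → (∀ {s} → ¬ Central s → ∃ λ L → length L ≤ k × Determines (s ∷ L) s) →
          ∀ n → 4 ≤ n → HasElementOfOrderAtLeast G (F n) →
          ∀ {S r} → IsGeneratingSet G S → HasSize G S r → let m = suc k * r in
          2 * m * m + 28 * m ≤ n + 4 → GRRExtension S (2 * m * m + 28 * m)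
    grr 1≤k nc-colours n 4≤n (a , order) {S} S-gen S-size room =
      Bound.grr-extension n nonabelian 1≤k nc-colours (torsionFreeUpTo (2K²<F 4≤n) order) S-gen S-size room

    2≤size : ∀ {S r} → IsGeneratingSet G S → HasSize G S r → 2 ≤ r
    2≤size S-gen (xs , _ , S⇔xs , ≡.refl) = two-generators nonabelian {5} (s≤s z≤n)
      (noncentral-colours nondicyclic) (IsGeneratingSet.generates S-gen) (λ {s} → Equivalence.to (S⇔xs s))

    private
      weaken : ∀ {S b b′} → b ≤ b′ → GRRExtension S b → GRRExtension S b′
      weaken b≤b′ (T , T-gen , t , sym , S⊆T , grr , size , t≤b) =
        T , T-gen , t , sym , S⊆T , grr , size , ≤-trans t≤b b≤b′

    -- With 6r labels the size is 72r² + 168r ≤ 240r² ≤ 512r² = 32r²·4², and 4 ≤ r² turns this into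
    -- 32r⁶.
    general : ∀ {S r} → IsGeneratingSet G S → HasSize G S r → HasElementOfOrderAtLeast G (F (32 * r ^ 6)) →
              GRRExtension S (32 * r ^ 6)
    general {S} {r} S-gen S-size large = weaken small
        (grr (s≤s z≤n) (noncentral-colours nondicyclic) (32 * r ^ 6) 4≤ large S-gen S-size (≤-trans small (m≤m+n _ 4)))
      where
      2≤r : 2 ≤ r
      2≤r = 2≤size S-gen S-size

      r≤r² : r ≤ r * r
      r≤r² = ≤-trans (≤-reflexive (≡.sym (ℕ.*-identityʳ r))) (*-monoʳ-≤ r (≤-trans (s≤s z≤n) 2≤r))

      quadratic : ∀ r → 2 * (6 * r) * (6 * r) + 28 * (6 * r) ≡ 72 * (r * r) + 168 * r
      quadratic = solve-∀

      collect : ∀ s → 72 * s + 168 * s ≡ 240 * s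
      collect = solve-∀

      factor : ∀ s → 512 * s ≡ 32 * (s * (4 * 4))
      factor = solve-∀

      sixth : ∀ r → 32 * (r * r * (r * r * (r * r))) ≡ 32 * (r * (r * (r * (r * (r * (r * 1))))))
      sixth = solve-∀

      512r²≤32r⁶ : 512 * (r * r) ≤ 32 * r ^ 6
      512r²≤32r⁶ = begin
        512 * (r * r)                              ≡⟨ factor (r * r) ⟩
        32 * (r * r * (4 * 4))                   ≤⟨ *-monoʳ-≤ 32 (*-monoʳ-≤ (r * r) (*-mono-≤ 4≤r² 4≤r²)) ⟩
        32 * (r * r * (r * r * (r * r)))      ≡⟨ sixth r ⟩
        32 * r ^ 6                                  ∎
        where
        open ≤-Reasoning
        4≤r² : 4 ≤ r * r
        4≤r² = *-mono-≤ 2≤r 2≤r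

      small : 2 * (6 * r) * (6 * r) + 28 * (6 * r) ≤ 32 * r ^ 6
      small = begin
        2 * (6 * r) * (6 * r) + 28 * (6 * r)  ≡⟨ quadratic r ⟩
        72 * (r * r) + 168 * r                    ≤⟨ +-monoʳ-≤ (72 * (r * r)) (*-monoʳ-≤ 168 r≤r²) ⟩
        72 * (r * r) + 168 * (r * r)             ≡⟨ collect (r * r) ⟩
        240 * (r * r)                                ≤⟨ *-monoˡ-≤ (r * r) (m≤m+n 240 272) ⟩
        512 * (r * r)                                ≤⟨ 512r²≤32r⁶ ⟩
        32 * r ^ 6                                    ∎
        where open ≤-Reasoning

      4≤ : 4 ≤ 32 * r ^ 6
      4≤ = begin
        4                ≤⟨ *-mono-≤ 2≤r 2≤r ⟩
        r * r           ≤⟨ m≤n*m (r * r) 512 ⟩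
        512 * (r * r)  ≤⟨ 512r²≤32r⁶ ⟩
        32 * r ^ 6      ∎
        where open ≤-Reasoning

    -- With 3r labels the size is exactly 18r² + 84r. It is at least 8, so that n, four less,
    -- satisfies both n ≥ 4 and the condition on the room.
    special : NoElementOfOrder4 G ⊎ NoNontrivialCharacteristicAbelianSubgroup G →
              ∀ {S r} → IsGeneratingSet G S → HasSize G S r →
              HasElementOfOrderAtLeast G (F (18 * r ^ 2 + 84 * r ∸ 4)) → GRRExtension S (18 * r ^ 2 + 84 * r)
    special hyp {S} {r} S-gen S-size large = weaken (≤-reflexive (size-eq r))
        (grr (s≤s z≤n) (noncentral-colours′ nondicyclic hyp) (18 * r ^ 2 + 84 * r ∸ 4) (∸-monoˡ-≤ 4 8≤) large S-gen S-size
          (≤-trans (≤-reflexive (size-eq r)) (≤-trans (m≤n+m∸n _ 4) (≤-reflexive (ℕ.+-comm 4 _)))))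
      where
      8≤ : 8 ≤ 18 * r ^ 2 + 84 * r
      8≤ = begin
        8                           ≤⟨ m≤m+n 8 160 ⟩
        84 * 2                     ≤⟨ *-monoʳ-≤ 84 (2≤size S-gen S-size) ⟩
        84 * r                     ≤⟨ m≤n+m (84 * r) (18 * r ^ 2) ⟩
        18 * r ^ 2 + 84 * r      ∎
        where open ≤-Reasoning

      size-eq : ∀ r → 2 * (3 * r) * (3 * r) + 28 * (3 * r) ≡ 18 * (r * (r * 1)) + 84 * r
      size-eq = solve-∀

corollary11 : {c ℓ : Level} → ExcludedMiddle (lsuc (c ⊔ ℓ)) →
    (G : Group c ℓ) → FinitelyGenerated G →
    ¬ IsGeneralizedDicyclic G → ¬ IsAbelian G →
    (∀ r → HasRank G r →
    HasElementOfOrderAtLeast G (F (32 * r ^ 6)) →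
    HasGRROfValencyAtMost G (32 * r ^ 6))
    ×
    (NoElementOfOrder4 G ⊎ NoNontrivialCharacteristicAbelianSubgroup G →
    ∀ r → HasRank G r →
    HasElementOfOrderAtLeast G (F (18 * r ^ 2 + 84 * r ∸ 4)) →
    HasGRROfValencyAtMost G (18 * r ^ 2 + 84 * r))
    ×
    ((∀ n → HasElementOfOrderAtLeast G n) →
    (S : Subset G) (s : ℕ) → IsGeneratingSet G S → HasSize G S s →
    (∃ λ (T : Subset G) → ∃ λ (T-gen : IsGeneratingSet G T) → ∃ λ t →
    IsSymmetricSet G T × S ⊆ T × IsGRR G (Cay G T T-gen) ×
    HasSize G T t × t ≤ 32 * s ^ 6)
    ×
    (NoElementOfOrder4 G ⊎ NoNontrivialCharacteristicAbelianSubgroup G →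
    ∃ λ (T : Subset G) → ∃ λ (T-gen : IsGeneratingSet G T) → ∃ λ t →
    IsSymmetricSet G T × S ⊆ T × IsGRR G (Cay G T T-gen) ×
    HasSize G T t × t ≤ 18 * s ^ 2 + 84 * s))
corollary11 em G _ nondicyclic nonabelian =
    (λ r ((S , S-gen , S-size) , _) large → hasGRR (general nondicyclic nonabelian S-gen S-size large))
  , (λ hyp r ((S , S-gen , S-size) , _) large → hasGRR (special nondicyclic nonabelian hyp S-gen S-size large))
  , (λ large S s S-gen S-size →
        general nondicyclic nonabelian S-gen S-size (large _)
      , λ hyp → special nondicyclic nonabelian hyp S-gen S-size (large _))
  where
  open CayleyGraphs em G using (hasGRR)
  open Orders em G using (general; special)
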